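{- Let $i\in\{0,1\}$ and let $G$ be a $(3,i)$-saturated subcubic graph such that $g_3(G)=3$. Then: (1) if $i=0$, $G$ is $(1,1,2,4)$-packing colorable; (2) if $i=1$, $G$ is $(1,1,2,3)$-packing colorable.
   Context: All graphs are finite, simple and undirected. For a non-decreasing sequence $S=(s_1,\dots,s_k)$ of positive integers, an $S$-packing coloring of $G$ is a partition of $V(G)$ into sets $V_1,\dots,V_k$ such that any two distinct vertices $u,v\in V_i$ satisfy $dist_G(u,v)>s_i$; $G$ is $S$-packing colorable if it admits one. $G$ is subcubic if its maximum degree is at most $3$. In a subcubic graph, a vertex of degree $3$ is heavy if all its neighbors have degree $3$. A subcubic graph is $(3,k)$-saturated ($0\le k\le 3$) if each heavy vertex is adjacent to at most $k$ heavy vertices. The local girth $g(v)$ of a vertex $v$ is the length of a shortest cycle containing $v$ ($\infty$ if none), and $g_3(G)=\max\{g(v): d_G(v)=3\}$. -}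

module Defs where

open import Data.Nat using (ℕ; zero; suc; _≤_; _<_)
open import Data.Bool using (Bool; true; false; _∧_; if_then_else_)
open import Data.Fin using (Fin; zero; suc; inject₁; fromℕ)
open import Data.List using (List; map; allFin)
open import Data.Nat.ListAction using (sum)
open import Data.Bool.ListAction using (all)
open import Data.Vec using (Vec; lookup)
open import Data.Nat using (_≡ᵇ_)
open import Data.Product using (Σ; _×_; ∃)
open import Relation.Binary.PropositionalEquality using (_≡_)
open import Relation.Nullary using (¬_)
open import Function.Definitions using (Injective)

record Graph : Set where
  field
    n      : ℕ
    Adj    : Fin n → Fin n → Bool
    sym    : ∀ u v → Adj u v ≡ Adj v u
    irrefl : ∀ u → Adj u u ≡ false

open Graph public

V : Graph → Set
V G = Fin (n G)

deg : (G : Graph) → V G → ℕ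
deg G u = sum (map (λ v → if Adj G u v then 1 else 0) (allFin (n G)))

Subcubic : Graph → Set
Subcubic G = ∀ u → deg G u ≤ 3

heavyᵇ : (G : Graph) → V G → Bool
heavyᵇ G v = (deg G v ≡ᵇ 3) ∧ all (λ w → if Adj G v w then deg G w ≡ᵇ 3 else true) (allFin (n G))

Heavy : (G : Graph) → V G → Set
Heavy G v = heavyᵇ G v ≡ true

heavyNeighbours : (G : Graph) → V G → ℕ
heavyNeighbours G v = sum (map (λ w → if Adj G v w ∧ heavyᵇ G w then 1 else 0) (allFin (n G)))

Saturated3 : Graph → ℕ → Set
Saturated3 G k = ∀ v → Heavy G v → heavyNeighbours G v ≤ k

data Walk (G : Graph) : V G → V G → ℕ → Set where
  here : ∀ {u} → Walk G u u 0
  step : ∀ {u w v l} → Adj G u w ≡ true → Walk G w v l → Walk G u v (suc l)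

-- dist_G(u,v) ≤ s  (distance is ∞ between different components)
DistLe : (G : Graph) → V G → V G → ℕ → Set
DistLe G u v s = Σ ℕ λ l → l ≤ s × Walk G u v l

PackingColoring : (G : Graph) {k : ℕ} → Vec ℕ k → (V G → Fin k) → Set
PackingColoring G S c =
  ∀ u v → ¬ (u ≡ v) → c u ≡ c v → ¬ DistLe G u v (lookup S (c u))

PackingColorable : (G : Graph) {k : ℕ} → Vec ℕ k → Set
PackingColorable G {k} S = Σ (V G → Fin k) λ c → PackingColoring G S c

record Cycle (G : Graph) (m : ℕ) : Set where
  field
    vert   : Fin (suc (suc (suc m))) → V G
    inj    : Injective _≡_ _≡_ vert
    adj    : ∀ (i : Fin (suc (suc m))) → Adj G (vert (inject₁ i)) (vert (suc i)) ≡ true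
    close  : Adj G (vert (fromℕ (suc (suc m)))) (vert zero) ≡ true

OnCycleOfLength : (G : Graph) → V G → ℕ → Set
OnCycleOfLength G v len =
  Σ ℕ λ m → (suc (suc (suc m)) ≡ len) × Σ (Cycle G m) λ C → ∃ λ i → Cycle.vert C i ≡ v

LocalGirth : (G : Graph) → V G → ℕ → Set
LocalGirth G v len = OnCycleOfLength G v len × (∀ l → l < len → ¬ OnCycleOfLength G v l)

-- g_3(G) = len: max of g(v) over degree-3 vertices equals the finite value len,
-- i.e. every degree-3 vertex has finite local girth ≤ len, and some
-- degree-3 vertex has local girth exactly len.
G3Eq : Graph → ℕ → Set
G3Eq G len =
  (∀ v → deg G v ≡ 3 → Σ ℕ λ g → LocalGirth G v g × g ≤ len)
  × Σ (V G) λ v → deg G v ≡ 3 × LocalGirth G v len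

{-# OPTIONS --safe #-}
module Submission where

-- Remove a set D meeting every triangle: then G − D has maximum degree 2, and it remains to make D
-- a 2-packing and to deal with the odd cycles of G − D. In each triangle D takes one vertex that has no
-- neighbour of degree 3 outside the triangle. If a triangle offers a choice, alternating along paths
-- (2-colouring a union of two matchings) keeps the chosen vertices at distance at least 3, and
-- exchanging the choice in a triangle crossed by a cycle of G − D opens that cycle without closing another.
-- What remains are cycles through triangles without a choice, which are even, and cycles which with
-- their neighbours in D fill a whole component of G; one vertex on each of those gets the fourth colour.
-- Two triangles without a choice may still have chosen vertices at distance 2; one of the two gets
-- the fourth colour, and saturation keeps these vertices at distance at least 4 from each other.
-- When heavy vertices have no heavy neighbour this last conflict does not arise.

open import Defs hiding (sym)
open import Algebra.Bundles using (CommutativeRing)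
open import Data.Bool using (Bool; true; false; not; _∧_; _xor_; if_then_else_)
import Data.Bool as Bool
open import Data.Bool.ListAction using (all)
open import Data.Bool.Properties using (xor-∧-commutativeRing; xor-same; xor-assoc; ∧-comm; ¬-not; not-¬; not-involutive)
open import Algebra.Properties.CommutativeMonoid.Sum (CommutativeRing.+-commutativeMonoid xor-∧-commutativeRing)
  using (∑-distrib-+; sum-cong-≗; sum-replicate-zero) renaming (sum to parity)
open import Data.Empty using (⊥; ⊥-elim)
open import Data.Fin using (Fin; zero; suc)
import Data.Fin as Fin
open import Data.Fin.Induction using () renaming (<-wellFounded to <-wellFoundedᶠ)
open import Data.Fin.Properties using (_≟_; any?; all?; ¬∀⟶∃¬; _<?_)
import Data.Fin.Properties as Fin
open import Data.Fin.Subset using (Subset; _∈_; _∉_; _⊆_; _-_; ∣_∣; _∩_)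
open import Data.Fin.Subset.Properties using (_∈?_; x∈p⇒∣p-x∣<∣p∣; x∈p∧x≢y⇒x∈p-y; p─q⊆p; anySubset?; x∈p∩q⁺; x∈p∩q⁻)
open import Data.List using (List; []; _∷_; _++_; map; length; filter; allFin)
open import Data.List.Membership.Propositional using () renaming (_∈_ to _∈ˡ_)
open import Data.List.Membership.Propositional.Properties using (∈-filter⁺; ∈-filter⁻; ∈-allFin; ∈-∃++; ∈-++⁻; ∈-++⁺ˡ; ∈-++⁺ʳ)
open import Data.List.Properties using (length-++)
open import Data.List.Relation.Unary.All using (All; []; _∷_)
import Data.List.Relation.Unary.All as All
open import Data.List.Relation.Unary.AllPairs using ([]; _∷_)
open import Data.List.Relation.Unary.Any using (Any; here; there)
import Data.List.Relation.Unary.Any as Any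
open import Data.List.Relation.Unary.Unique.Propositional using (Unique)
import Data.List.Relation.Unary.Unique.Propositional.Properties as Unique
open import Data.Nat using (ℕ; zero; suc; _≤_; _<_; z≤n; s≤s; _≡ᵇ_)
open import Data.Nat.Induction using (<-wellFounded)
open import Data.Nat.ListAction using (sum)
import Data.Nat.Properties as ℕ
open import Data.Product using (Σ; ∃; ∃₂; _×_; _,_; proj₁; proj₂) renaming (swap to swap×)
open import Data.Sum using (_⊎_; inj₁; inj₂; [_,_]′)
open import Data.Vec using (Vec; tabulate; lookup; []; _∷_)
open import Data.Vec.Properties using (lookup∘tabulate; []=⇒lookup; lookup⇒[]=)
open import Function using (_∘_; id)
open import Induction.WellFounded using (Acc; acc)
open import Relation.Binary using (tri<; tri≈; tri>)
open import Relation.Binary.PropositionalEquality using (_≡_; _≢_; refl; sym; trans; cong; cong₂; subst; module ≡-Reasoning)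
open import Relation.Nullary using (¬_; Dec; yes; no; does; contradiction)
open import Relation.Nullary.Decidable using (_×-dec_; _⊎-dec_; _→-dec_; ¬?; dec-true; dec-false; map′; decidable-stable)
open import Relation.Unary using (Decidable)

-- Since g_3 = 3, every vertex of degree 3 lies in a triangle; this is what bounds the degrees in G
-- - D. Diamonds K₄ - e stand apart: their two triangles share both inner vertices, so one inner
-- vertex serves both, and all its neighbours lie in the diamond. In any other triangle, three
-- vertices with outer neighbours of degree 3 would all be heavy, each with two heavy neighbours, so
-- saturation leaves a candidate. A cycle is never traversed. It is encoded as a set of vertices off
-- D with two neighbours each in the set, closed under neighbours off D; following it to its other
-- end becomes a count of odd degrees. The two sources of the fourth colour never meet: a component
-- filled by such a cycle and its neighbours in D has no candidate in D, while conflicts occur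
-- between candidates. If heavy vertices have no heavy neighbour, the fourth class has at most one
-- vertex in each component, so any radius would do in place of 4.

-- Finite subsets and counting

module _ {n} {P : Fin n → Set} (P? : Decidable P) where

  abstract
    ⟦_⟧ : Subset n
    ⟦_⟧ = tabulate (λ x → does (P? x))

    ∈⟦⟧⁺ : ∀ {x} → P x → x ∈ ⟦_⟧
    ∈⟦⟧⁺ {x} px = lookup⇒[]= x ⟦_⟧ (trans (lookup∘tabulate (does ∘ P?) x) (dec-true (P? x) px))

    ∈⟦⟧⁻ : ∀ {x} → x ∈ ⟦_⟧ → P x
    ∈⟦⟧⁻ {x} x∈ with P? x in eq
    ... | yes px = px
    ... | no _ = contradiction (trans (sym ([]=⇒lookup x∈)) (trans (lookup∘tabulate (does ∘ P?) x) (cong does eq))) λ ()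

module _ {A : Set} where

  unique-length : ∀ {xs ys : List A} → Unique xs → (∀ {x} → x ∈ˡ xs → x ∈ˡ ys) → length xs ≤ length ys
  unique-length [] _ = z≤n
  unique-length {x ∷ xs} {ys} (x∉xs ∷ u) incl with ∈-∃++ (incl (here refl))
  ... | as , bs , refl = subst (suc (length xs) ≤_) len (s≤s (unique-length u incl′))
    where
    len : suc (length (as ++ bs)) ≡ length (as ++ x ∷ bs)
    len = trans (cong suc (length-++ as)) (trans (sym (ℕ.+-suc (length as) (length bs))) (sym (length-++ as)))
    incl′ : ∀ {z} → z ∈ˡ xs → z ∈ˡ as ++ bs
    incl′ z∈ with ∈-++⁻ as (incl (there z∈))
    ... | inj₁ z∈as = ∈-++⁺ˡ z∈as
    ... | inj₂ (here refl) = contradiction refl (All.lookup x∉xs z∈)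
    ... | inj₂ (there z∈bs) = ∈-++⁺ʳ as z∈bs

module _ {n} (f : Fin n → Bool) where

  count : ℕ
  count = sum (map (λ v → if f v then 1 else 0) (allFin n))

  support : List (Fin n)
  support = filter (λ v → f v Bool.≟ true) (allFin n)

  support-unique : Unique support
  support-unique = Unique.filter⁺ (λ v → f v Bool.≟ true) (Unique.allFin⁺ n)

  ∈-support⁻ : ∀ {v} → v ∈ˡ support → f v ≡ true
  ∈-support⁻ v∈ = proj₂ (∈-filter⁻ (λ v → f v Bool.≟ true) {xs = allFin n} v∈)

  length-support : length support ≡ count
  length-support = go (allFin n)
    where
    go : ∀ xs → length (filter (λ v → f v Bool.≟ true) xs) ≡ sum (map (λ v → if f v then 1 else 0) xs)
    go [] = refl
    go (x ∷ xs) with f x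
    ... | true = cong suc (go xs)
    ... | false = go xs

  unique-count : ∀ {xs} → Unique xs → All (λ v → f v ≡ true) xs → length xs ≤ count
  unique-count u all = subst (_ ≤_) length-support
    (unique-length u λ v∈ → ∈-filter⁺ (λ v → f v Bool.≟ true) (∈-allFin _) (All.lookup all v∈))

-- Parity

-- Induction on `n`: by symmetry the first row and the first column have the same parity and cancel.
handshake : ∀ {n} (R : Fin n → Fin n → Bool) → (∀ i j → R i j ≡ R j i) → (∀ i → R i i ≡ false) →
  parity (λ i → parity (R i)) ≡ false
handshake {zero} R _ _ = refl
handshake {suc n} R R-sym R-irrefl = begin
  (R zero zero xor r) xor parity (λ i → R (suc i) zero xor parity (R (suc i) ∘ suc))
    ≡⟨ cong₂ _xor_ (cong (_xor r) (R-irrefl zero)) (∑-distrib-+ (λ i → R (suc i) zero) (λ i → parity (R (suc i) ∘ suc))) ⟩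
  r xor (parity (λ i → R (suc i) zero) xor parity (λ i → parity (R (suc i) ∘ suc)))
    ≡⟨ cong (r xor_) (cong₂ _xor_ (sum-cong-≗ (λ i → R-sym (suc i) zero))
         (handshake (λ i j → R (suc i) (suc j)) (λ i j → R-sym (suc i) (suc j)) (R-irrefl ∘ suc))) ⟩
  r xor (r xor false)
    ≡⟨ xor-assoc r r false ⟨
  (r xor r) xor false
    ≡⟨ cong (_xor false) (xor-same r) ⟩
  false ∎
  where
  open ≡-Reasoning
  r : Bool
  r = parity (R zero ∘ suc)

parity-false : ∀ {n} (f : Fin n → Bool) → (∀ i → f i ≡ false) → parity f ≡ false
parity-false {n} f f≡ = trans (sum-cong-≗ f≡) (sum-replicate-zero n)

parity-one : ∀ {n} (f : Fin n → Bool) p → f p ≡ true → (∀ i → f i ≡ true → i ≡ p) → parity f ≡ true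
parity-one f zero fp only = cong₂ _xor_ fp (parity-false (f ∘ suc) off)
  where
  off : ∀ i → f (suc i) ≡ false
  off i = ¬-not λ fi → contradiction (only (suc i) fi) λ ()
parity-one f (suc p) fp only = cong₂ _xor_ (¬-not λ f0 → contradiction (only zero f0) λ ())
  (parity-one (f ∘ suc) p fp λ i fi → Fin.suc-injective (only (suc i) fi))

parity-two : ∀ {n} (f : Fin n → Bool) p q → p ≢ q → f p ≡ true → f q ≡ true →
  (∀ i → f i ≡ true → i ≡ p ⊎ i ≡ q) → parity f ≡ false
parity-two f zero zero p≢q _ _ _ = contradiction refl p≢q
parity-two f zero (suc q) _ fp fq only = cong₂ _xor_ fp (parity-one (f ∘ suc) q fq only′)
  where
  only′ : ∀ i → f (suc i) ≡ true → i ≡ q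
  only′ i fi with only (suc i) fi
  ... | inj₂ refl = refl
parity-two f (suc p) zero _ fp fq only = cong₂ _xor_ fq (parity-one (f ∘ suc) p fp only′)
  where
  only′ : ∀ i → f (suc i) ≡ true → i ≡ p
  only′ i fi with only (suc i) fi
  ... | inj₁ refl = refl
parity-two f (suc p) (suc q) p≢q fp fq only = cong₂ _xor_
  (¬-not λ f0 → [ (λ ()) , (λ ()) ]′ (only zero f0))
  (parity-two (f ∘ suc) p q (p≢q ∘ cong suc) fp fq only′)
  where
  only′ : ∀ i → f (suc i) ≡ true → i ≡ p ⊎ i ≡ q
  only′ i fi with only (suc i) fi
  ... | inj₁ refl = inj₁ refl
  ... | inj₂ refl = inj₂ refl

-- Two-colouring the union of two matchings

module TwoMatchings {n : ℕ} where

  private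
    Rel₂ : Set₁
    Rel₂ = Fin n → Fin n → Set

    Touches : Fin n → List (Fin n × Fin n) → Set
    Touches v = Any λ (a , b) → v ≡ a ⊎ v ≡ b

    touches? : ∀ v L → Dec (Touches v L)
    touches? v = Any.any? λ (a , b) → (v ≟ a) ⊎-dec (v ≟ b)

    data Disjoint : List (Fin n × Fin n) → Set where
      []  : Disjoint []
      add : ∀ {a b L} → a ≢ b → ¬ Touches a L → ¬ Touches b L → Disjoint L → Disjoint ((a , b) ∷ L)

  record Matching (E : Fin n → Fin n → Set) : Set where
    field
      decide     : ∀ u v → Dec (E u v)
      symmetric  : ∀ {u v} → E u v → E v u
      irreflexive : ∀ {u} → ¬ E u u
      functional : ∀ {u v w} → E u v → E u w → v ≡ w

  private
    -- Relative to `S` because a shortcut is a matching only on the vertices that remain: the old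
    -- partner of a removed vertex is related both to that vertex and to its new partner.
    record MatchingOn (S : Fin n → Set) (E : Rel₂) : Set where
      field
        decide      : ∀ u v → Dec (E u v)
        symmetric   : ∀ {u v} → E u v → E v u
        irreflexive : ∀ {u} → S u → ¬ E u u
        functional  : ∀ {u v w} → S u → S v → S w → E u v → E u w → v ≡ w

    -- Delete a and b and join the E-partner of a to the E-partner of b: a colouring
    -- proper for the shortcut extends to a and b with different colours.
    Shortcut : Fin n → Fin n → Rel₂ → Rel₂
    Shortcut a b E u v = E u v ⊎ (E u a × E b v) ⊎ (E u b × E a v)

    colour-pairs : ∀ L → Disjoint L → ∀ E → MatchingOn (λ v → Touches v L) E →
      Σ (Fin n → Bool) λ c → All (λ (a , b) → c a ≢ c b) L ×
        (∀ {u v} → Touches u L → Touches v L → E u v → c u ≢ c v)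
    colour-pairs [] _ E _ = (λ _ → true) , [] , λ ()
    colour-pairs ((a , b) ∷ L) (add a≢b a∉ b∉ L-disj) E mE = c , pairs , proper
      where
      open MatchingOn mE
      in-a : Touches a ((a , b) ∷ L)
      in-a = here (inj₁ refl)
      in-b : Touches b ((a , b) ∷ L)
      in-b = here (inj₂ refl)

      shortcut-matching : MatchingOn (λ v → Touches v L) (Shortcut a b E)
      shortcut-matching = record
        { decide = λ u v → decide u v ⊎-dec (decide u a ×-dec decide b v) ⊎-dec (decide u b ×-dec decide a v)
        ; symmetric = λ
          { (inj₁ e) → inj₁ (symmetric e)
          ; (inj₂ (inj₁ (e , f))) → inj₂ (inj₂ (symmetric f , symmetric e))
          ; (inj₂ (inj₂ (e , f))) → inj₂ (inj₁ (symmetric f , symmetric e)) }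
        ; irreflexive = λ
          { u∈ (inj₁ e) → irreflexive (there u∈) e
          ; u∈ (inj₂ (inj₁ (e , f))) → a≢b (functional (there u∈) in-a in-b e (symmetric f))
          ; u∈ (inj₂ (inj₂ (e , f))) → a≢b (functional (there u∈) in-a in-b (symmetric f) e) }
        ; functional = fun }
        where
        apart : ∀ {u v x} → Touches u L → Touches v L → Touches x ((a , b) ∷ L) → ¬ Touches x L → E u v → ¬ E u x
        apart u∈ v∈ x∈ x∉ e f = x∉ (subst (λ w → Touches w L) (functional (there u∈) (there v∈) x∈ e f) v∈)
        fun : ∀ {u v w} → Touches u L → Touches v L → Touches w L → Shortcut a b E u v → Shortcut a b E u w → v ≡ w
        fun u∈ v∈ w∈ (inj₁ e) (inj₁ f) = functional (there u∈) (there v∈) (there w∈) e f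
        fun u∈ v∈ w∈ (inj₁ e) (inj₂ (inj₁ (f , _))) = ⊥-elim (apart u∈ v∈ in-a a∉ e f)
        fun u∈ v∈ w∈ (inj₁ e) (inj₂ (inj₂ (f , _))) = ⊥-elim (apart u∈ v∈ in-b b∉ e f)
        fun u∈ v∈ w∈ (inj₂ (inj₁ (e , _))) (inj₁ f) = ⊥-elim (apart u∈ w∈ in-a a∉ f e)
        fun u∈ v∈ w∈ (inj₂ (inj₂ (e , _))) (inj₁ f) = ⊥-elim (apart u∈ w∈ in-b b∉ f e)
        fun u∈ v∈ w∈ (inj₂ (inj₁ (_ , e))) (inj₂ (inj₁ (_ , f))) = functional in-b (there v∈) (there w∈) e f
        fun u∈ v∈ w∈ (inj₂ (inj₂ (_ , e))) (inj₂ (inj₂ (_ , f))) = functional in-a (there v∈) (there w∈) e f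
        fun u∈ v∈ w∈ (inj₂ (inj₁ (e , _))) (inj₂ (inj₂ (f , _))) = ⊥-elim (a≢b (functional (there u∈) in-a in-b e f))
        fun u∈ v∈ w∈ (inj₂ (inj₂ (e , _))) (inj₂ (inj₁ (f , _))) = ⊥-elim (a≢b (functional (there u∈) in-a in-b f e))

      rest = colour-pairs L L-disj (Shortcut a b E) shortcut-matching
      c′ : Fin n → Bool
      c′ = proj₁ rest

      partner? : ∀ x → Dec (∃ λ p → Touches p L × E x p)
      partner? x = any? λ p → touches? p L ×-dec decide x p

      not-≢ : ∀ {x y} → x ≡ not y → x ≢ y
      not-≢ e f = not-¬ f e

      Avoids : Fin n → Bool → Set
      Avoids x cx = ∀ {v} → Touches v L → E x v → cx ≢ c′ v

      avoid : ∀ {x p} → Touches x ((a , b) ∷ L) → Touches p L → E x p → Avoids x (not (c′ p))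
      avoid {x} {p} x∈ p∈ e v∈ f =
        not-≢ (cong (not ∘ c′) (functional x∈ (there p∈) (there v∈) e f))

      ends : ∃₂ λ ca cb → ca ≢ cb × Avoids a ca × Avoids b cb
      ends with partner? a | partner? b
      -- The shortcut joins `p` and `q`, so their colours differ, and hence so do the opposite ones.
      -- If a partner is missing, that end is free to take the colour opposite to the other end.
      ... | yes (p , p∈ , ap) | yes (q , q∈ , bq) =
        not (c′ p) , not (c′ q) ,
        (λ e → proj₂ (proj₂ rest) p∈ q∈ (inj₂ (inj₁ (symmetric ap , bq)))
                 (trans (sym (not-involutive _)) (trans (cong not e) (not-involutive _)))) ,
        avoid in-a p∈ ap , avoid in-b q∈ bq
      ... | yes (p , p∈ , ap) | no ¬q =
        not (c′ p) , c′ p , not-≢ refl , avoid in-a p∈ ap , λ v∈ f → ⊥-elim (¬q (_ , v∈ , f))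
      ... | no ¬p | yes (q , q∈ , bq) =
        c′ q , not (c′ q) , (λ e → not-≢ refl (sym e)) , (λ v∈ f → ⊥-elim (¬p (_ , v∈ , f))) , avoid in-b q∈ bq
      ... | no ¬p | no ¬q =
        true , false , (λ ()) , (λ v∈ f → ⊥-elim (¬p (_ , v∈ , f))) , λ v∈ f → ⊥-elim (¬q (_ , v∈ , f))

      ca cb : Bool
      ca = proj₁ ends
      cb = proj₁ (proj₂ ends)
      ca≢cb = proj₁ (proj₂ (proj₂ ends))
      avoid-a = proj₁ (proj₂ (proj₂ (proj₂ ends)))
      avoid-b = proj₂ (proj₂ (proj₂ (proj₂ ends)))

      c : Fin n → Bool
      c v = if does (v ≟ a) then ca else if does (v ≟ b) then cb else c′ v

      c-a : c a ≡ ca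
      c-a rewrite dec-true (a ≟ a) refl = refl
      c-b : c b ≡ cb
      c-b rewrite dec-false (b ≟ a) (a≢b ∘ sym) | dec-true (b ≟ b) refl = refl
      c-L : ∀ {v} → Touches v L → c v ≡ c′ v
      c-L {v} v∈ rewrite dec-false (v ≟ a) (λ { refl → a∉ v∈ }) | dec-false (v ≟ b) (λ { refl → b∉ v∈ }) = refl

      transport : {s t x y : Bool} → s ≡ x → t ≡ y → x ≢ y → s ≢ t
      transport refl refl x≢y = x≢y

      pairs : All (λ (x , y) → c x ≢ c y) ((a , b) ∷ L)
      pairs = transport c-a c-b ca≢cb ∷ All.tabulate λ {(x , y)} xy∈ →
        transport (c-L (Any.map (λ { refl → inj₁ refl }) xy∈)) (c-L (Any.map (λ { refl → inj₂ refl }) xy∈))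
          (All.lookup (proj₁ (proj₂ rest)) xy∈)

      proper : ∀ {u v} → Touches u ((a , b) ∷ L) → Touches v ((a , b) ∷ L) → E u v → c u ≢ c v
      proper (here (inj₁ refl)) (here (inj₁ refl)) e = ⊥-elim (irreflexive in-a e)
      proper (here (inj₁ refl)) (here (inj₂ refl)) e = transport c-a c-b ca≢cb
      proper (here (inj₂ refl)) (here (inj₁ refl)) e = transport c-b c-a (ca≢cb ∘ sym)
      proper (here (inj₂ refl)) (here (inj₂ refl)) e = ⊥-elim (irreflexive in-b e)
      proper (here (inj₁ refl)) (there v∈) e = transport c-a (c-L v∈) (avoid-a v∈ e)
      proper (here (inj₂ refl)) (there v∈) e = transport c-b (c-L v∈) (avoid-b v∈ e)
      proper (there u∈) (here (inj₁ refl)) e = transport (c-L u∈) c-a (avoid-a u∈ (symmetric e) ∘ sym)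
      proper (there u∈) (here (inj₂ refl)) e = transport (c-L u∈) c-b (avoid-b u∈ (symmetric e) ∘ sym)
      proper (there u∈) (there v∈) e = transport (c-L u∈) (c-L v∈) (proj₂ (proj₂ rest) u∈ v∈ (inj₁ e))

    matched-pairs : ∀ {E} → Matching E → (vs : List (Fin n)) →
      ∃ λ L → Disjoint L × All (λ (a , b) → E a b) L × (∀ {u v} → u ∈ˡ vs → E u v → Touches u L)
    matched-pairs mE [] = [] , [] , [] , λ ()
    matched-pairs {E} mE (x ∷ vs) with matched-pairs mE vs
    ... | L , disj , allE , covers with touches? x L | any? (Matching.decide mE x)
    ... | yes x∈ | _ = L , disj , allE , λ { (here refl) _ → x∈ ; (there u∈) e → covers u∈ e }
    ... | no _ | no ¬e = L , disj , allE , λ { (here refl) e → ⊥-elim (¬e (_ , e)) ; (there u∈) e → covers u∈ e }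
    ... | no x∉ | yes (y , xy) =
      (x , y) ∷ L , add (λ { refl → irreflexive xy }) x∉ y∉ disj , xy ∷ allE ,
      λ { (here refl) _ → here (inj₁ refl) ; (there u∈) e → there (covers u∈ e) }
      where
      open Matching mE
      partner-touches : ∀ {a b} → E a b → y ≡ a ⊎ y ≡ b → x ≡ a ⊎ x ≡ b
      partner-touches ab (inj₁ refl) = inj₂ (functional (symmetric xy) ab)
      partner-touches ab (inj₂ refl) = inj₁ (functional (symmetric xy) (symmetric ab))
      -- `L` consists of `E`-pairs, so a pair containing `y` would also contain its only partner
      -- `x`.
      y∉ : ¬ Touches y L
      y∉ y∈ = x∉ (go allE y∈)
        where
        go : ∀ {L} → All (λ (a , b) → E a b) L → Touches y L → Touches x L
        go (ab ∷ _) (here y∈) = here (partner-touches ab y∈)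
        go (_ ∷ all) (there y∈) = there (go all y∈)

  -- A union of two matchings consists of paths and even cycles. A vertex without an `E`-partner is
  -- in no listed pair and gets an uncontrolled colour; hence the two additional hypotheses for `F`.
  colour-two-matchings : ∀ {E F} → Matching E → Matching F →
    Σ (Fin n → Bool) λ c → (∀ {u v} → E u v → c u ≢ c v) ×
      (∀ {u u′ v v′} → E u u′ → E v v′ → F u v → c u ≢ c v)
  colour-two-matchings {E} {F} mE mF with matched-pairs mE (allFin n)
  ... | L , disj , allE , covers with colour-pairs L disj F (record
          { decide = Matching.decide mF ; symmetric = Matching.symmetric mF
          ; irreflexive = λ _ → Matching.irreflexive mF ; functional = λ _ _ _ → Matching.functional mF })
  ... | c , pairs , proper = c , proper-E , λ uu′ vv′ → proper (covers (∈-allFin _) uu′) (covers (∈-allFin _) vv′)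
    where
    open Matching mE
    proper-E : ∀ {u v} → E u v → c u ≢ c v
    proper-E {u} {v} uv = go allE pairs (covers (∈-allFin _) uv)
      where
      go : ∀ {L} → All (λ (a , b) → E a b) L → All (λ (a , b) → c a ≢ c b) L → Touches u L → c u ≢ c v
      go (ab ∷ _) (a≢b ∷ _) (here (inj₁ refl)) with functional uv ab
      ... | refl = a≢b
      go (ab ∷ _) (a≢b ∷ _) (here (inj₂ refl)) with functional uv (symmetric ab)
      ... | refl = a≢b ∘ sym
      go (_ ∷ all) (_ ∷ ps) (there u∈) = go all ps u∈

-- Adjacency, peeling and components

module Adjacency (G : Graph) where

  infix 4 _~_
  _~_ : V G → V G → Set
  u ~ v = Adj G u v ≡ true

  _~?_ : ∀ u v → Dec (u ~ v)
  u ~? v = Adj G u v Bool.≟ true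

  ~-sym : ∀ {u v} → u ~ v → v ~ u
  ~-sym {u} {v} uv = trans (Graph.sym G v u) uv

  ~-irrefl : ∀ {u v} → u ~ v → u ≢ v
  ~-irrefl {u} uu refl = contradiction (trans (sym uu) (irrefl G u)) λ ()

  Deg3 : V G → Set
  Deg3 u = ∃ λ p → ∃ λ q → ∃ λ r → p ≢ q × p ≢ r × q ≢ r × u ~ p × u ~ q × u ~ r

  deg3? : ∀ u → Dec (Deg3 u)
  deg3? u = any? λ p → any? λ q → any? λ r →
    ¬? (p ≟ q) ×-dec ¬? (p ≟ r) ×-dec ¬? (q ≟ r) ×-dec (u ~? p) ×-dec (u ~? q) ×-dec (u ~? r)

  three-distinct : ∀ {p q r : V G} → p ≢ q → p ≢ r → q ≢ r → Unique (p ∷ q ∷ r ∷ [])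
  three-distinct pq pr qr = (pq ∷ pr ∷ []) ∷ (qr ∷ []) ∷ [] ∷ []

  deg≡3⇒Deg3 : ∀ {u} → deg G u ≡ 3 → Deg3 u
  deg≡3⇒Deg3 {u} deg≡ = go (support (Adj G u)) (trans (length-support (Adj G u)) deg≡)
      (support-unique (Adj G u)) (All.tabulate (∈-support⁻ (Adj G u)))
    where
    go : ∀ xs → length xs ≡ 3 → Unique xs → All (u ~_) xs → Deg3 u
    go (p ∷ q ∷ r ∷ []) refl ((pq ∷ pr ∷ []) ∷ (qr ∷ []) ∷ _) (up ∷ uq ∷ ur ∷ []) =
      p , q , r , pq , pr , qr , up , uq , ur

  Two : Subset (n G) → V G → Set
  Two A u = ∃₂ λ p q → p ≢ q × (u ~ p × p ∈ A) × (u ~ q × q ∈ A)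

  two? : ∀ A u → Dec (Two A u)
  two? A u = any? λ p → any? λ q → ¬? (p ≟ q) ×-dec (u ~? p ×-dec p ∈? A) ×-dec (u ~? q ×-dec q ∈? A)

  -- By the handshake lemma, no induced subgraph has exactly one vertex of odd degree.
  no-single-end : ∀ {A z z′} → z ∈ A → z ~ z′ → z′ ∈ A → (∀ {v} → z ~ v → v ∈ A → v ≡ z′) →
    (∀ {w} → w ∈ A → w ≢ z → ∃₂ λ p q → p ≢ q × (w ~ p × p ∈ A) × (w ~ q × q ∈ A) ×
       (∀ {v} → w ~ v → v ∈ A → v ≡ p ⊎ v ≡ q)) → ⊥
  no-single-end {A} {z} {z′} z∈ zz′ z′∈ end pass =
    contradiction (trans (sym (handshake R R-sym R-irrefl)) odd) λ ()
    where
    R : V G → V G → Bool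
    R u v = does (u ∈? A ×-dec v ∈? A) ∧ Adj G u v

    R⁺ : ∀ {u v} → u ∈ A → v ∈ A → u ~ v → R u v ≡ true
    R⁺ {u} {v} u∈ v∈ uv rewrite dec-true (u ∈? A ×-dec v ∈? A) (u∈ , v∈) = uv

    R⁻ : ∀ {u v} → R u v ≡ true → u ∈ A × v ∈ A × u ~ v
    R⁻ {u} {v} r with u ∈? A | v ∈? A
    ... | yes u∈ | yes v∈ = u∈ , v∈ , r

    R-sym : ∀ u v → R u v ≡ R v u
    R-sym u v = cong₂ _∧_ (∧-comm (does (u ∈? A)) (does (v ∈? A))) (Graph.sym G u v)

    R-irrefl : ∀ u → R u u ≡ false
    R-irrefl u = ¬-not λ r → ~-irrefl (proj₂ (proj₂ (R⁻ r))) refl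

    even : ∀ {w} → Dec (w ∈ A) → w ≢ z → parity (R w) ≡ false
    even {w} (no w∉) _ = parity-false (R w) λ v → ¬-not (w∉ ∘ proj₁ ∘ R⁻)
    even {w} (yes w∈) w≢z with pass w∈ w≢z
    ... | p , q , p≢q , (wp , p∈) , (wq , q∈) , only =
      parity-two (R w) p q p≢q (R⁺ w∈ p∈ wp) (R⁺ w∈ q∈ wq)
        λ v r → only (proj₂ (proj₂ (R⁻ r))) (proj₁ (proj₂ (R⁻ r)))

    odd-only-z : ∀ w → parity (R w) ≡ true → w ≡ z
    odd-only-z w odd-w = decidable-stable (w ≟ z) λ w≢z →
      contradiction (trans (sym (even (w ∈? A) w≢z)) odd-w) λ ()

    odd : parity (λ w → parity (R w)) ≡ true
    odd = parity-one (λ w → parity (R w)) z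
      (parity-one (R z) z′ (R⁺ z∈ z′∈ zz′) λ v r → end (proj₂ (proj₂ (R⁻ r))) (proj₁ (proj₂ (R⁻ r))))
      odd-only-z

  Colourable : Subset (n G) → Set
  Colourable A = Σ (V G → Bool) λ c → ∀ {u v} → u ∈ A → v ∈ A → u ~ v → c u ≢ c v

  -- Vertices with at most one neighbour in the set can be removed and coloured last.
  peel : ∀ A → (∀ B → B ⊆ A → (∀ {u} → u ∈ B → Two B u) → Colourable B) → Colourable A
  peel A = go A (<-wellFounded ∣ A ∣)
    where
    go : ∀ A → Acc _<_ ∣ A ∣ → (∀ B → B ⊆ A → (∀ {u} → u ∈ B → Two B u) → Colourable B) → Colourable A
    go A (acc rec) core with all? (λ u → u ∈? A →-dec two? A u)
    ... | yes all-two = core A id (all-two _)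
    ... | no ¬all with ¬∀⟶∃¬ _ _ (λ u → u ∈? A →-dec two? A u) ¬all
    ... | u , ¬two = c , proper
      where
      u∈ : u ∈ A
      u∈ = decidable-stable (u ∈? A) λ u∉ → ¬two λ u∈ → contradiction u∈ u∉
      rest = go (A - u) (rec (x∈p⇒∣p-x∣<∣p∣ u∈)) λ B B⊆ → core B (p─q⊆p A _ ∘ B⊆)
      c′ : V G → Bool
      c′ = proj₁ rest
      nbr? : Dec (∃ λ w → u ~ w × w ∈ A)
      nbr? = any? λ w → u ~? w ×-dec w ∈? A
      colour : Dec (∃ λ w → u ~ w × w ∈ A) → Bool
      colour (yes (w , _)) = not (c′ w)
      colour (no _) = true
      colour-≢ : ∀ d {v} → u ~ v → v ∈ A → colour d ≢ c′ v
      colour-≢ (no ¬w) uv v∈ = contradiction (_ , uv , v∈) ¬w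
      colour-≢ (yes (w , uw , w∈)) {v} uv v∈ with w ≟ v
      ... | yes refl = λ e → not-¬ refl (sym e)
      ... | no w≢v = contradiction (λ _ → w , v , w≢v , (uw , w∈) , (uv , v∈)) ¬two
      c : V G → Bool
      c v = if does (v ≟ u) then colour nbr? else c′ v
      c-u : c u ≡ colour nbr?
      c-u rewrite dec-true (u ≟ u) refl = refl
      c-≢ : ∀ {v} → v ≢ u → c v ≡ c′ v
      c-≢ {v} v≢u rewrite dec-false (v ≟ u) v≢u = refl
      proper : ∀ {v w} → v ∈ A → w ∈ A → v ~ w → c v ≢ c w
      proper {v} {w} v∈ w∈ vw with v ≟ u | w ≟ u
      ... | yes refl | yes refl = contradiction refl (~-irrefl vw)
      ... | yes refl | no w≢u = λ e → colour-≢ nbr? vw w∈ e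
      ... | no v≢u | yes refl = λ e → colour-≢ nbr? (~-sym vw) v∈ (sym e)
      ... | no v≢u | no w≢u = proj₂ rest (x∈p∧x≢y⇒x∈p-y v∈ v≢u) (x∈p∧x≢y⇒x∈p-y w∈ w≢u) vw

  -- v lies in every adjacency-closed set containing u, i.e. in the component of u; this form is decidable.
  Closed : Subset (n G) → Set
  Closed C = ∀ u v → u ∈ C → u ~ v → v ∈ C

  Linked : V G → V G → Set
  Linked u v = ∀ C → Closed C → u ∈ C → v ∈ C

  linked? : ∀ u v → Dec (Linked u v)
  linked? u v = map′
    (λ ¬sep C cl u∈ → decidable-stable (v ∈? C) λ v∉ → ¬sep (C , cl , u∈ , v∉))
    (λ link (C , cl , u∈ , v∉) → v∉ (link C cl u∈))
    (¬? (anySubset? λ C → closed? C ×-dec u ∈? C ×-dec ¬? (v ∈? C)))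
    where
    closed? : ∀ C → Dec (Closed C)
    closed? C = all? λ u → all? λ v → u ∈? C →-dec u ~? v →-dec v ∈? C

  walk⇒linked : ∀ {u v l} → Walk G u v l → Linked u v
  walk⇒linked here C cl u∈ = u∈
  walk⇒linked (step uw walk) C cl u∈ = walk⇒linked walk C cl (cl _ _ u∈ uw)

  walk⇒linked′ : ∀ {u v l} → Walk G u v l → Linked v u
  walk⇒linked′ here C cl v∈ = v∈
  walk⇒linked′ (step uw walk) C cl v∈ = cl _ _ (walk⇒linked′ walk C cl v∈) (~-sym uw)

  record IsHeavy (u : V G) : Set where
    constructor mkHeavy
    field
      deg3      : Deg3 u
      nbrs-deg3 : ∀ {v} → u ~ v → Deg3 v

-- Consequences of maximum degree 3

module Subcubic-Graph (G : Graph) (subcubic : Subcubic G) where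
  open Adjacency G public

  third : ∀ {u p q r w} → p ≢ q → p ≢ r → q ≢ r → u ~ p → u ~ q → u ~ r → u ~ w → w ≡ p ⊎ w ≡ q ⊎ w ≡ r
  third {u} {p} {q} {r} {w} pq pr qr up uq ur uw with w ≟ p | w ≟ q | w ≟ r
  ... | yes e | _ | _ = inj₁ e
  ... | no _ | yes e | _ = inj₂ (inj₁ e)
  ... | no _ | no _ | yes e = inj₂ (inj₂ e)
  ... | no wp | no wq | no wr = contradiction
    (ℕ.≤-trans (unique-count (Adj G u) ((wp ∷ wq ∷ wr ∷ []) ∷ three-distinct pq pr qr) (uw ∷ up ∷ uq ∷ ur ∷ [])) (subcubic u))
    ℕ.1+n≰n

  Deg3⇒deg≡3 : ∀ {u} → Deg3 u → deg G u ≡ 3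
  Deg3⇒deg≡3 {u} (p , q , r , pq , pr , qr , up , uq , ur) = ℕ.≤-antisym (subcubic u)
    (unique-count (Adj G u) (three-distinct pq pr qr) (up ∷ uq ∷ ur ∷ []))

  isHeavy⇒Heavy : ∀ {u} → IsHeavy u → Heavy G u
  isHeavy⇒Heavy {u} h rewrite Deg3⇒deg≡3 (IsHeavy.deg3 h) = go (allFin (n G))
    where
    go : ∀ xs → all (λ w → if Adj G u w then deg G w ≡ᵇ 3 else true) xs ≡ true
    go [] = refl
    go (w ∷ xs) with Adj G u w in eq
    ... | false = go xs
    ... | true rewrite Deg3⇒deg≡3 (IsHeavy.nbrs-deg3 h eq) = go xs

  heavy-nbrs : ∀ {k u ws} → Saturated3 G k → IsHeavy u → Unique ws → All (λ w → u ~ w × IsHeavy w) ws → length ws ≤ k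
  heavy-nbrs {u = u} sat hu uniq hws = ℕ.≤-trans
    (unique-count (λ w → Adj G u w ∧ heavyᵇ G w) uniq (All.map (λ (uw , hw) → cong₂ _∧_ uw (isHeavy⇒Heavy hw)) hws))
    (sat _ (isHeavy⇒Heavy hu))

  two-nbrs : ∀ {m u v w} → ¬ Deg3 m → u ≢ v → m ~ u → m ~ v → m ~ w → w ≡ u ⊎ w ≡ v
  two-nbrs {u = u} {v} {w} ¬3 u≢v mu mv mw with w ≟ u | w ≟ v
  ... | yes e | _ = inj₁ e
  ... | no _ | yes e = inj₂ e
  ... | no w≢u | no w≢v = contradiction (_ , _ , _ , u≢v , w≢u ∘ sym , w≢v ∘ sym , mu , mv , mw) ¬3

-- Triangles and diamonds

module Triangles (G : Graph) where
  open Adjacency G public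

  Triangle : V G → V G → V G → Set
  Triangle x y z = x ~ y × x ~ z × y ~ z

  InTri : V G → Set
  InTri u = ∃₂ λ p q → Triangle u p q

  Mate : V G → V G → Set
  Mate u v = u ~ v × ∃ λ w → u ~ w × v ~ w

  -- The two vertices of degree 3 inside a diamond K₄ − e.
  Twin : V G → V G → Set
  Twin u v = u ~ v × ∃₂ λ c d → c ≢ d × (u ~ c × v ~ c) × (u ~ d × v ~ d)

  Centre : V G → Set
  Centre u = ∃ λ v → Twin u v

  InDiamond : V G → Set
  InDiamond u = ∃ λ a → Centre a × (u ≡ a ⊎ a ~ u)

  -- D avoids tight vertices: any choice in the triangle of v would lie within distance 2 of u.
  Tight : V G → Set
  Tight u = ∃ λ v → u ~ v × ¬ Mate u v × Deg3 v

  Candidate : V G → Set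
  Candidate u = InTri u × ¬ InDiamond u × ¬ Tight u

  -- The vertex that `D` takes from a diamond; comparing indices selects one of the two inner
  -- vertices.
  Leader : V G → Set
  Leader u = ∃ λ v → Twin u v × u Fin.< v

  -- The only way in which candidates of different triangles can be at distance 2: a middle vertex
  -- of degree 3 would make them tight.
  Conflict : V G → V G → Set
  Conflict u v = u ≢ v × ∃ λ m → u ~ m × v ~ m × ¬ Mate u m × ¬ Mate v m × ¬ Deg3 m

  inTri? : ∀ u → Dec (InTri u)
  inTri? u = any? λ p → any? λ q → u ~? p ×-dec u ~? q ×-dec p ~? q

  mate? : ∀ u v → Dec (Mate u v)
  mate? u v = u ~? v ×-dec any? λ w → u ~? w ×-dec v ~? w

  twin? : ∀ u v → Dec (Twin u v)
  twin? u v = u ~? v ×-dec any? λ c → any? λ d →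
    ¬? (c ≟ d) ×-dec (u ~? c ×-dec v ~? c) ×-dec (u ~? d ×-dec v ~? d)

  inDiamond? : ∀ u → Dec (InDiamond u)
  inDiamond? u = any? λ a → any? (twin? a) ×-dec (u ≟ a ⊎-dec a ~? u)

  tight? : ∀ u → Dec (Tight u)
  tight? u = any? λ v → u ~? v ×-dec ¬? (mate? u v) ×-dec deg3? v

  candidate? : ∀ u → Dec (Candidate u)
  candidate? u = inTri? u ×-dec ¬? (inDiamond? u) ×-dec ¬? (tight? u)

  leader? : ∀ u → Dec (Leader u)
  leader? u = any? λ v → twin? u v ×-dec u <? v

  conflict? : ∀ u v → Dec (Conflict u v)
  conflict? u v = ¬? (u ≟ v) ×-dec any? λ m →
    u ~? m ×-dec v ~? m ×-dec ¬? (mate? u m) ×-dec ¬? (mate? v m) ×-dec ¬? (deg3? m)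

  rotate : ∀ {x y z} → Triangle x y z → Triangle y z x
  rotate (xy , xz , yz) = yz , ~-sym xy , ~-sym xz

  flip : ∀ {x y z} → Triangle x y z → Triangle x z y
  flip (xy , xz , yz) = xz , xy , ~-sym yz

  triangle⇒mate : ∀ {x y z} → Triangle x y z → Mate x y
  triangle⇒mate {z = z} (xy , xz , yz) = xy , z , xz , yz

  mate-sym : ∀ {u v} → Mate u v → Mate v u
  mate-sym (uv , w , uw , vw) = ~-sym uv , w , vw , uw

  mate-irrefl : ∀ {u} → ¬ Mate u u
  mate-irrefl (uu , _) = ~-irrefl uu refl

  mate⇒inTri : ∀ {u v} → Mate u v → InTri u
  mate⇒inTri (uv , w , uw , vw) = _ , w , uv , uw , vw

  twin-sym : ∀ {u v} → Twin u v → Twin v u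
  twin-sym (uv , c , d , c≢d , (uc , vc) , (ud , vd)) = ~-sym uv , c , d , c≢d , (vc , uc) , (vd , ud)

  conflict-sym : ∀ {u v} → Conflict u v → Conflict v u
  conflict-sym (u≢v , m , um , vm , ¬um , ¬vm , ¬3) = u≢v ∘ sym , m , vm , um , ¬vm , ¬um , ¬3

  deg3-by-outer : ∀ {u v} → InTri u → u ~ v → ¬ Mate u v → Deg3 u
  deg3-by-outer (p , q , up , uq , pq) uv ¬m =
    p , q , _ , ~-irrefl pq , (λ { refl → ¬m (uv , q , uq , pq) }) , (λ { refl → ¬m (uv , p , up , ~-sym pq) }) , up , uq , uv

module LocalStructure (G : Graph) (subcubic : Subcubic G) (sat : Saturated3 G 1)
                      (deg3⇒inTri : ∀ {u} → Adjacency.Deg3 G u → Triangles.InTri G u) where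
  open Triangles G public
  open Subcubic-Graph G subcubic public using (third; two-nbrs; heavy-nbrs)

  -- Saturation with bound 1 enters only here. `no-K₄`, `not-all-tight` and `diamond-exit` apply it
  -- to a triangle of heavy vertices, `bumped-far₃` to a heavy vertex with one heavy neighbour
  -- inside its triangle and one further along a walk.
  heavy-nbr-unique : ∀ {u v w} → IsHeavy u → IsHeavy v → IsHeavy w → u ~ v → u ~ w → v ≡ w
  heavy-nbr-unique {u} {v} {w} hu hv hw uv uw with v ≟ w
  ... | yes v≡w = v≡w
  ... | no v≢w = contradiction (heavy-nbrs sat hu ((v≢w ∷ []) ∷ [] ∷ []) ((uv , hv) ∷ (uw , hw) ∷ [])) λ { (s≤s ()) }

  no-K₄ : ∀ {a b c d} → a ~ b → a ~ c → a ~ d → b ~ c → b ~ d → c ~ d → ⊥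
  no-K₄ ab ac ad bc bd cd = ~-irrefl bc (heavy-nbr-unique
      (heavy ab ac ad bc bd cd) (heavy (~-sym ab) bc bd ac ad cd) (heavy (~-sym ac) (~-sym bc) cd ab ad bd) ab ac)
    where
    d3 : ∀ {a b c d} → a ~ b → a ~ c → a ~ d → b ~ c → b ~ d → c ~ d → Deg3 a
    d3 ab ac ad bc bd cd = _ , _ , _ , ~-irrefl bc , ~-irrefl bd , ~-irrefl cd , ab , ac , ad
    heavy : ∀ {a b c d} → a ~ b → a ~ c → a ~ d → b ~ c → b ~ d → c ~ d → IsHeavy a
    heavy {a} ab ac ad bc bd cd = mkHeavy (d3 ab ac ad bc bd cd) nbrs
      where
      nbrs : ∀ {v} → a ~ v → Deg3 v
      nbrs av with third (~-irrefl bc) (~-irrefl bd) (~-irrefl cd) ab ac ad av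
      ... | inj₁ refl = d3 (~-sym ab) bc bd ac ad cd
      ... | inj₂ (inj₁ refl) = d3 (~-sym ac) (~-sym bc) cd ab ad bd
      ... | inj₂ (inj₂ refl) = d3 (~-sym ad) (~-sym bd) (~-sym cd) ab ac bc

  record Diamond (a b c d : V G) : Set where
    constructor diamond
    field
      ab  : a ~ b
      c≢d : c ≢ d
      ac  : a ~ c
      bc  : b ~ c
      ad  : a ~ d
      bd  : b ~ d

    nbr : ∀ {v} → a ~ v → v ≡ b ⊎ v ≡ c ⊎ v ≡ d
    nbr = third (~-irrefl bc) (~-irrefl bd) c≢d ab ac ad

    twin : Twin a b
    twin = ab , c , d , c≢d , (ac , bc) , (ad , bd)

    swap-centres : Diamond b a c d
    swap-centres = record { ab = ~-sym ab ; c≢d = c≢d ; ac = bc ; bc = ac ; ad = bd ; bd = ad }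

    swap-ends : Diamond a b d c
    swap-ends = record { ab = ab ; c≢d = c≢d ∘ sym ; ac = ad ; bc = bd ; ad = ac ; bd = bc }

    ¬cd : ¬ c ~ d
    ¬cd cd = no-K₄ ab ac ad bc bd cd

    ¬twin-ac : ¬ Twin a c
    ¬twin-ac (_ , m , m′ , m≢m′ , (am , cm) , (am′ , cm′)) with nbr am | nbr am′
    ... | inj₂ (inj₁ refl) | _ = ~-irrefl cm refl
    ... | inj₂ (inj₂ refl) | _ = ¬cd cm
    ... | _ | inj₂ (inj₁ refl) = ~-irrefl cm′ refl
    ... | _ | inj₂ (inj₂ refl) = ¬cd cm′
    ... | inj₁ refl | inj₁ refl = m≢m′ refl

  twin⇒diamond : ∀ {a b} → Twin a b → ∃₂ λ c d → Diamond a b c d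
  twin⇒diamond (ab , c , d , c≢d , (ac , bc) , (ad , bd)) = c , d , diamond ab c≢d ac bc ad bd

  twin-unique : ∀ {a b b′} → Twin a b → Twin a b′ → b ≡ b′
  twin-unique t t′ with twin⇒diamond t
  ... | c , d , dia with Diamond.nbr dia (proj₁ t′)
  ... | inj₁ e = sym e
  ... | inj₂ (inj₁ refl) = ⊥-elim (Diamond.¬twin-ac dia t′)
  ... | inj₂ (inj₂ refl) = ⊥-elim (Diamond.¬twin-ac (Diamond.swap-ends dia) t′)

  -- A twin `t` of `c` other than `a` and `b` would be its third neighbour. The neighbours of `a`
  -- are already `b`, `c`, `d`, so only `b` could be common to `c` and `t`, whereas twins share two
  -- neighbours.
  end-not-centre : ∀ {a b c d} → Diamond a b c d → ¬ Centre c
  end-not-centre {a} {b} {c} {d} dia (t , tw@(ct , m , m′ , m≢m′ , (cm , tm) , (cm′ , tm′))) with t ≟ a | t ≟ b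
  ... | yes refl | _ = Diamond.¬twin-ac dia (twin-sym tw)
  ... | _ | yes refl = Diamond.¬twin-ac (Diamond.swap-centres dia) (twin-sym tw)
  ... | no t≢a | no t≢b = go (nbr-c cm) (nbr-c cm′)
    where
    open Diamond dia
    nbr-c : ∀ {v} → c ~ v → v ≡ a ⊎ v ≡ b ⊎ v ≡ t
    nbr-c = third (~-irrefl ab) (t≢a ∘ sym) (t≢b ∘ sym) (~-sym ac) (~-sym bc) ct
    ¬ta : ¬ t ~ a
    ¬ta ta with nbr (~-sym ta)
    ... | inj₁ t≡b = t≢b t≡b
    ... | inj₂ (inj₁ refl) = ~-irrefl ct refl
    ... | inj₂ (inj₂ refl) = ¬cd ct
    go : m ≡ a ⊎ m ≡ b ⊎ m ≡ t → m′ ≡ a ⊎ m′ ≡ b ⊎ m′ ≡ t → ⊥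
    go (inj₁ refl) _ = ¬ta tm
    go _ (inj₁ refl) = ¬ta tm′
    go (inj₂ (inj₂ refl)) _ = ~-irrefl tm refl
    go _ (inj₂ (inj₂ refl)) = ~-irrefl tm′ refl
    go (inj₂ (inj₁ refl)) (inj₂ (inj₁ refl)) = m≢m′ refl

  centre-mate : ∀ {u v} → Centre u → u ~ v → Mate u v
  centre-mate (b , t) uv with twin⇒diamond t
  ... | c , d , dia with Diamond.nbr dia uv
  ... | inj₁ refl = uv , c , Diamond.ac dia , Diamond.bc dia
  ... | inj₂ (inj₁ refl) = uv , b , Diamond.ab dia , ~-sym (Diamond.bc dia)
  ... | inj₂ (inj₂ refl) = uv , b , Diamond.ab dia , ~-sym (Diamond.bd dia)

  centre⇒inDiamond : ∀ {u} → Centre u → InDiamond u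
  centre⇒inDiamond ce = _ , ce , inj₁ refl

  end-mate : ∀ {a b c d v w} → Diamond a b c d → c ~ v → c ~ w → v ~ w → InDiamond v
  end-mate {a} {b} {v = v} dia cv cw vw with v ≟ a | v ≟ b
  ... | yes refl | _ = a , (b , Diamond.twin dia) , inj₁ refl
  ... | _ | yes refl = a , (b , Diamond.twin dia) , inj₂ (Diamond.ab dia)
  ... | no v≢a | no v≢b with third (~-irrefl (Diamond.ab dia)) (v≢a ∘ sym) (v≢b ∘ sym) (~-sym (Diamond.ac dia)) (~-sym (Diamond.bc dia)) cv cw
  ... | inj₁ refl = a , (b , Diamond.twin dia) , inj₂ (~-sym vw)
  ... | inj₂ (inj₁ refl) = b , (a , twin-sym (Diamond.twin dia)) , inj₂ (~-sym vw)
  ... | inj₂ (inj₂ refl) = ⊥-elim (~-irrefl vw refl)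

  inDiamond-mate : ∀ {u v} → InDiamond u → Mate u v → InDiamond v
  inDiamond-mate (a , ce , inj₁ refl) (uv , _) = a , ce , inj₂ uv
  inDiamond-mate (a , (b , t) , inj₂ au) (uv , w , uw , vw) with twin⇒diamond t
  ... | c , d , dia with Diamond.nbr dia au
  ... | inj₁ refl = b , (a , twin-sym t) , inj₂ uv
  ... | inj₂ (inj₁ refl) = end-mate dia uv uw vw
  ... | inj₂ (inj₂ refl) = end-mate (Diamond.swap-ends dia) uv uw vw

  -- A third mate would share `p` or `q` with `u` and make that edge the middle of a diamond. So
  -- outside diamonds each vertex has at most one triangle.
  mates : ∀ {u p q v} → ¬ InDiamond u → Triangle u p q → Mate u v → v ≡ p ⊎ v ≡ q
  mates {u} {p} {q} {v} ¬d (up , uq , pq) (uv , w , uw , vw) with v ≟ p | v ≟ q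
  ... | yes e | _ = inj₁ e
  ... | _ | yes e = inj₂ e
  ... | no v≢p | no v≢q with third (~-irrefl pq) (v≢p ∘ sym) (v≢q ∘ sym) up uq uv uw
  ... | inj₁ refl = ⊥-elim (¬d (centre⇒inDiamond (p , up , q , v , v≢q ∘ sym , (uq , pq) , (uv , ~-sym vw))))
  ... | inj₂ (inj₁ refl) = ⊥-elim (¬d (centre⇒inDiamond (q , uq , p , v , v≢p ∘ sym , (up , ~-sym pq) , (uv , ~-sym vw))))
  ... | inj₂ (inj₂ refl) = ⊥-elim (~-irrefl vw refl)

  outer-unique : ∀ {u m m′} → InTri u → u ~ m → ¬ Mate u m → u ~ m′ → ¬ Mate u m′ → m ≡ m′
  outer-unique {u} {m} {m′} (p , q , up , uq , pq) um ¬m um′ ¬m′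
    with third (~-irrefl pq) (λ { refl → ¬m (um , q , uq , pq) }) (λ { refl → ¬m (um , p , up , ~-sym pq) }) up uq um um′
  ... | inj₁ refl = ⊥-elim (¬m′ (um′ , q , uq , pq))
  ... | inj₂ (inj₁ refl) = ⊥-elim (¬m′ (um′ , p , up , ~-sym pq))
  ... | inj₂ (inj₂ refl) = refl

  tight⇒deg3 : ∀ {u} → InTri u → Tight u → Deg3 u
  tight⇒deg3 i (v , uv , ¬m , _) = deg3-by-outer i uv ¬m

  tight⇒heavy : ∀ {x y z} → Triangle x y z → Tight x → Deg3 y → Deg3 z → IsHeavy x
  tight⇒heavy {x} {y} {z} tr@(xy , xz , yz) tx@(t , xt , ¬m , 3t) 3y 3z = mkHeavy (tight⇒deg3 (y , z , tr) tx) nbrs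
    where
    nbrs : ∀ {v} → x ~ v → Deg3 v
    nbrs {v} xv with mate? x v
    ... | no ¬mv = subst Deg3 (outer-unique (y , z , tr) xt ¬m xv ¬mv) 3t
    ... | yes mv with third (~-irrefl yz) (λ { refl → ¬m (triangle⇒mate tr) }) (λ { refl → ¬m (triangle⇒mate (flip tr)) }) xy xz xt xv
    ... | inj₁ refl = 3y
    ... | inj₂ (inj₁ refl) = 3z
    ... | inj₂ (inj₂ refl) = 3t

  not-candidate⇒tight : ∀ {x} → InTri x → ¬ InDiamond x → ¬ Candidate x → Tight x
  not-candidate⇒tight {x} i ¬d ¬c = decidable-stable (tight? x) λ ¬t → ¬c (i , ¬d , ¬t)

  not-all-tight : ∀ {x y z} → Triangle x y z → Tight x → Tight y → Tight z → ⊥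
  not-all-tight tr@(xy , xz , yz) tx ty tz = ~-irrefl yz (heavy-nbr-unique
      (tight⇒heavy tr tx 3y 3z) (tight⇒heavy (rotate tr) ty 3z 3x) (tight⇒heavy (rotate (rotate tr)) tz 3x 3y) xy xz)
    where
    3x = tight⇒deg3 (_ , _ , tr) tx
    3y = tight⇒deg3 (_ , _ , rotate tr) ty
    3z = tight⇒deg3 (_ , _ , rotate (rotate tr)) tz

  candidate-exists : ∀ {x y z} → Triangle x y z → ¬ InDiamond x → Candidate x ⊎ Candidate y ⊎ Candidate z
  candidate-exists {x} {y} {z} tr ¬dx with candidate? x | candidate? y | candidate? z
  ... | yes c | _ | _ = inj₁ c
  ... | no _ | yes c | _ = inj₂ (inj₁ c)
  ... | no _ | no _ | yes c = inj₂ (inj₂ c)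
  ... | no ¬x | no ¬y | no ¬z = ⊥-elim (not-all-tight tr
        (not-candidate⇒tight (_ , _ , tr) ¬dx ¬x)
        (not-candidate⇒tight (_ , _ , rotate tr) (λ d → ¬dx (inDiamond-mate d (mate-sym (triangle⇒mate tr)))) ¬y)
        (not-candidate⇒tight (_ , _ , rotate (rotate tr)) (λ d → ¬dx (inDiamond-mate d (mate-sym (triangle⇒mate (flip tr))))) ¬z))

  twin⇒leader : ∀ {u v} → Twin u v → Leader u ⊎ Leader v
  twin⇒leader {u} {v} t with Fin.<-cmp u v
  ... | tri< u<v _ _ = inj₁ (v , t , u<v)
  ... | tri≈ _ refl _ = ⊥-elim (~-irrefl (proj₁ t) refl)
  ... | tri> _ _ v<u = inj₂ (u , twin-sym t , v<u)

  centre-triangle : ∀ {x y z} → Centre x → Triangle x y z → Leader x ⊎ Leader y ⊎ Leader z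
  centre-triangle (b , t) (xy , xz , yz) with twin⇒diamond t
  ... | c , d , dia with Diamond.nbr dia xy | Diamond.nbr dia xz
  ... | inj₁ refl | _ = [ inj₁ , inj₂ ∘ inj₁ ]′ (twin⇒leader t)
  ... | inj₂ _ | inj₁ refl = [ inj₁ , inj₂ ∘ inj₂ ]′ (twin⇒leader t)
  ... | inj₂ (inj₁ refl) | inj₂ (inj₁ refl) = ⊥-elim (~-irrefl yz refl)
  ... | inj₂ (inj₁ refl) | inj₂ (inj₂ refl) = ⊥-elim (Diamond.¬cd dia yz)
  ... | inj₂ (inj₂ refl) | inj₂ (inj₁ refl) = ⊥-elim (Diamond.¬cd dia (~-sym yz))
  ... | inj₂ (inj₂ refl) | inj₂ (inj₂ refl) = ⊥-elim (~-irrefl yz refl)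

  -- An end of a diamond has at most one neighbour besides the two centres, so a triangle there
  -- contains a centre; and a triangle at a centre contains the other centre too.
  diamond-triangle : ∀ {x y z} → InDiamond x → Triangle x y z → Leader x ⊎ Leader y ⊎ Leader z
  diamond-triangle (a , ce , inj₁ refl) tr = centre-triangle ce tr
  diamond-triangle {x} {y} {z} (a , ce@(b , t) , inj₂ ax) tr with twin⇒diamond t
  ... | c , d , dia with Diamond.nbr dia ax
  ... | inj₁ refl = centre-triangle (a , twin-sym t) tr
  ... | inj₂ other = from (y ≟ a) (y ≟ b) (bx other)
    where
    bx : x ≡ c ⊎ x ≡ d → b ~ x
    bx (inj₁ refl) = Diamond.bc dia
    bx (inj₂ refl) = Diamond.bd dia
    via-y : Centre y → Leader x ⊎ Leader y ⊎ Leader z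
    via-y cy = [ inj₂ ∘ inj₁ , [ inj₂ ∘ inj₂ , inj₁ ]′ ]′ (centre-triangle cy (rotate tr))
    via-z : Centre z → Leader x ⊎ Leader y ⊎ Leader z
    via-z cz = [ inj₂ ∘ inj₂ , [ inj₁ , inj₂ ∘ inj₁ ]′ ]′ (centre-triangle cz (rotate (rotate tr)))
    from : Dec (y ≡ a) → Dec (y ≡ b) → b ~ x → Leader x ⊎ Leader y ⊎ Leader z
    from (yes refl) _ _ = via-y ce
    from (no _) (yes refl) _ = via-y (a , twin-sym t)
    from (no y≢a) (no y≢b) bx with third (~-irrefl (Diamond.ab dia)) (y≢a ∘ sym) (y≢b ∘ sym) (~-sym ax) (~-sym bx) (proj₁ tr) (proj₁ (proj₂ tr))
    ... | inj₁ refl = via-z ce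
    ... | inj₂ (inj₁ refl) = via-z (a , twin-sym t)
    ... | inj₂ (inj₂ refl) = ⊥-elim (~-irrefl (proj₂ (proj₂ tr)) refl)

  leader⇒centre : ∀ {u} → Leader u → Centre u
  leader⇒centre (v , t , _) = v , t

  leaders-apart : ∀ {u v} → Leader u → Leader v → ¬ u ~ v
  leaders-apart {u} (b , t , u<b) (b′ , t′ , v<b′) uv with twin⇒diamond t
  ... | c , d , dia with Diamond.nbr dia uv
  ... | inj₁ refl = Fin.<-asym u<b (subst (b Fin.<_) (twin-unique t′ (twin-sym t)) v<b′)
  ... | inj₂ (inj₁ refl) = end-not-centre dia (b′ , t′)
  ... | inj₂ (inj₂ refl) = end-not-centre (Diamond.swap-ends dia) (b′ , t′)

  -- Choosing one vertex in each triangle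

  Near : V G → V G → Set
  Near t c = t ≡ c ⊎ Mate t c

  Flexible : V G → Set
  Flexible t = ∃₂ λ c c′ → c ≢ c′ × (Candidate c × Near t c) × (Candidate c′ × Near t c′)

  flexible? : ∀ t → Dec (Flexible t)
  flexible? t = any? λ c → any? λ c′ → ¬? (c ≟ c′) ×-dec near-candidate? c ×-dec near-candidate? c′
    where
    near-candidate? : ∀ c → Dec (Candidate c × Near t c)
    near-candidate? c = candidate? c ×-dec (t ≟ c ⊎-dec mate? t c)

  near : ∀ {t p q c} → ¬ InDiamond t → Triangle t p q → Near t c → c ≡ t ⊎ c ≡ p ⊎ c ≡ q
  near ¬d tr (inj₁ refl) = inj₁ refl
  near ¬d tr (inj₂ m) = inj₂ (mates ¬d tr m)

  ¬inDiamond-mate : ∀ {u v} → ¬ InDiamond u → Mate u v → ¬ InDiamond v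
  ¬inDiamond-mate ¬d m d = ¬d (inDiamond-mate d (mate-sym m))

  candidate-deg3-nbr⇒mate : ∀ {u v} → Candidate u → u ~ v → Deg3 v → Mate u v
  candidate-deg3-nbr⇒mate {u} {v} (_ , _ , ¬t) uv 3v = decidable-stable (mate? u v) λ ¬m → ¬t (v , uv , ¬m , 3v)

  -- The middle vertex is the only neighbour of `u` outside its triangle, and with degree below 3 it
  -- has no neighbours but `u` and `v`.
  conflict-unique : ∀ {u v w} → Candidate u → Conflict u v → Conflict u w → v ≡ w
  conflict-unique (i , _) (u≢v , m , um , vm , ¬um , _ , ¬3) (u≢w , m′ , um′ , wm′ , ¬um′ , _)
    with outer-unique i um ¬um um′ ¬um′
  ... | refl with two-nbrs ¬3 u≢v (~-sym um) (~-sym vm) (~-sym wm′)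
  ... | inj₁ w≡u = contradiction (sym w≡u) u≢w
  ... | inj₂ w≡v = sym w≡v

  -- `free` is demanded only between two triangles with a choice; conflicts involving a triangle
  -- without one are left to the fourth colour.
  record Valid (D : Subset (n G)) : Set where
    field
      kind  : ∀ {x} → x ∈ D → Candidate x ⊎ Leader x
      apart : ∀ {x y} → x ∈ D → y ∈ D → ¬ Mate x y
      hit   : ∀ {x y z} → Triangle x y z → x ∈ D ⊎ y ∈ D ⊎ z ∈ D
      free  : ∀ {x y} → x ∈ D → y ∈ D → Flexible x → Flexible y → ¬ Conflict x y

    hit-candidate : ∀ {x} → x ∈ D → ¬ InDiamond x → Candidate x
    hit-candidate x∈ ¬d with kind x∈
    ... | inj₁ c = c
    ... | inj₂ l = contradiction (centre⇒inDiamond (leader⇒centre l)) ¬d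

  -- The two candidates between which a triangle chooses. Of three candidates the one of largest
  -- index is left out, so that the relation is a matching.
  Paired : V G → V G → Set
  Paired u v = Mate u v × Candidate u × Candidate v ×
    (∀ w → Mate u w → Candidate w → w ≢ v → u Fin.< w × v Fin.< w)

  make-pair : ∀ {x y z} → Triangle x y z → Candidate x → Candidate y →
    (Candidate z → x Fin.< z × y Fin.< z) → Paired x y
  make-pair {x} {y} {z} tr cx@(_ , ¬d , _) cy below = triangle⇒mate tr , cx , cy , rest
    where
    rest : ∀ w → Mate x w → Candidate w → w ≢ y → x Fin.< w × y Fin.< w
    rest w m cw w≢y with mates ¬d tr m
    ... | inj₁ w≡y = contradiction w≡y w≢y
    ... | inj₂ refl = below cw

  paired-matching : TwoMatchings.Matching Paired
  paired-matching = record
    { decide = λ u v → mate? u v ×-dec candidate? u ×-dec candidate? v ×-dec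
        all? λ w → mate? u w →-dec candidate? w →-dec ¬? (w ≟ v) →-dec u <? w ×-dec v <? w
    ; symmetric = symm
    ; irreflexive = mate-irrefl ∘ proj₁
    ; functional = func }
    where
    symm : ∀ {u v} → Paired u v → Paired v u
    symm {u} {v} ((uv , t , ut , vt) , cu , cv@(_ , ¬d , _) , least) =
      make-pair (~-sym uv , vt , ut) cv cu λ ct → swap× (least t (ut , v , uv , ~-sym vt) ct (~-irrefl vt ∘ sym))
    func : ∀ {u v w} → Paired u v → Paired u w → v ≡ w
    func {u} {v} {w} (uv , _ , cv , least) (uw , _ , cw , least′) = decidable-stable (v ≟ w) λ v≢w →
      Fin.<-asym (proj₂ (least w uw cw (v≢w ∘ sym))) (proj₂ (least′ v uv cv v≢w))

  conflict-matching : TwoMatchings.Matching (λ u v → Candidate u × Candidate v × Conflict u v)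
  conflict-matching = record
    { decide = λ u v → candidate? u ×-dec candidate? v ×-dec conflict? u v
    ; symmetric = λ (cu , cv , uv) → cv , cu , conflict-sym uv
    ; irreflexive = λ (_ , _ , u≢u , _) → u≢u refl
    ; functional = λ (cu , _ , uv) (_ , _ , uw) → conflict-unique cu uv uw }

  valid-exists : ∃ Valid
  valid-exists with TwoMatchings.colour-two-matchings paired-matching conflict-matching
  ... | c , pair-≢ , conflict-≢ = D , record
    { kind = λ x∈ → kind (∈⟦⟧⁻ chosen? x∈)
    ; apart = λ x∈ y∈ → apart (∈⟦⟧⁻ chosen? x∈) (∈⟦⟧⁻ chosen? y∈)
    ; hit = λ tr → [ inj₁ ∘ ∈⟦⟧⁺ chosen? , [ inj₂ ∘ inj₁ ∘ ∈⟦⟧⁺ chosen? , inj₂ ∘ inj₂ ∘ ∈⟦⟧⁺ chosen? ]′ ]′ (hit tr)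
    ; free = λ x∈ y∈ → free (∈⟦⟧⁻ chosen? x∈) (∈⟦⟧⁻ chosen? y∈) }
    where
    Chosen : V G → Set
    -- Each pair has exactly one vertex coloured `true`, and two paired vertices in conflict are
    -- never both `true`.
    Chosen u = Leader u ⊎ Candidate u × (¬ Flexible u ⊎ (∃ λ v → Paired u v) × c u ≡ true)

    chosen? : ∀ u → Dec (Chosen u)
    chosen? u = leader? u ⊎-dec candidate? u ×-dec
      (¬? (flexible? u) ⊎-dec any? (TwoMatchings.Matching.decide paired-matching u) ×-dec c u Bool.≟ true)

    D : Subset (n G)
    D = ⟦ chosen? ⟧

    kind : ∀ {x} → Chosen x → Candidate x ⊎ Leader x
    kind (inj₁ l) = inj₂ l
    kind (inj₂ (cx , _)) = inj₁ cx

    mixed : ∀ {x y} → Leader x → Candidate y → ¬ Mate x y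
    mixed l (_ , ¬d , _) m = ¬d (inDiamond-mate (centre⇒inDiamond (leader⇒centre l)) m)

    apart : ∀ {x y} → Chosen x → Chosen y → ¬ Mate x y
    apart (inj₁ lx) (inj₁ ly) m = leaders-apart lx ly (proj₁ m)
    apart (inj₁ lx) (inj₂ (cy , _)) m = mixed lx cy m
    apart (inj₂ (cx , _)) (inj₁ ly) m = mixed ly cx (mate-sym m)
    apart (inj₂ (cx , inj₁ ¬f)) (inj₂ (cy , _)) m =
      ¬f (_ , _ , ~-irrefl (proj₁ m) , (cx , inj₁ refl) , (cy , inj₂ m))
    apart (inj₂ (cx , inj₂ _)) (inj₂ (cy , inj₁ ¬f)) m =
      ¬f (_ , _ , ~-irrefl (proj₁ m) , (cx , inj₂ (mate-sym m)) , (cy , inj₁ refl))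
    apart {x} {y} (inj₂ (cx , inj₂ ((v , xv) , tx))) (inj₂ (cy , inj₂ ((w , yw) , ty))) m =
      Fin.<-asym (proj₁ (proj₂ (proj₂ (proj₂ xv)) y m cy y≢v)) (proj₁ (proj₂ (proj₂ (proj₂ yw)) x (mate-sym m) cx x≢w))
      where
      y≢v : y ≢ v
      y≢v refl = pair-≢ xv (trans tx (sym ty))
      x≢w : x ≢ w
      x≢w refl = pair-≢ yw (trans ty (sym tx))

    from-pair : ∀ {x y} → Paired x y → Chosen x ⊎ Chosen y
    from-pair {x} {y} xy@(_ , cx , cy , _) with c x Bool.≟ true
    ... | yes eq = inj₁ (inj₂ (cx , inj₂ ((y , xy) , eq)))
    ... | no neq = inj₂ (inj₂ (cy , inj₂ ((x , TwoMatchings.Matching.symmetric paired-matching xy) ,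
                    ¬-not λ e → pair-≢ xy (trans (¬-not neq) (sym e)))))

    rigid : ∀ {x y z} → Triangle x y z → Candidate x → ¬ Candidate y → ¬ Candidate z → Chosen x
    rigid {x} {y} {z} tr cx@(_ , ¬d , _) ¬cy ¬cz = inj₂ (cx , inj₁ λ (_ , _ , e≢ , a , b) → e≢ (trans (only a) (sym (only b))))
      where
      only : ∀ {e} → Candidate e × Near x e → e ≡ x
      only (ce , ne) with near ¬d tr ne
      ... | inj₁ e≡x = e≡x
      ... | inj₂ (inj₁ refl) = contradiction ce ¬cy
      ... | inj₂ (inj₂ refl) = contradiction ce ¬cz

    Hits : V G → V G → V G → Set
    Hits x y z = Chosen x ⊎ Chosen y ⊎ Chosen z

    first-two : ∀ {x y z} → Triangle x y z → Candidate x → Candidate y → (Candidate z → x Fin.< z × y Fin.< z) → Hits x y z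
    first-two tr cx cy below = [ inj₁ , inj₂ ∘ inj₁ ]′ (from-pair (make-pair tr cx cy below))

    turn : ∀ {x y z} → Hits y z x → Hits x y z
    turn = [ inj₂ ∘ inj₁ , [ inj₂ ∘ inj₂ , inj₁ ]′ ]′

    all-three : ∀ {x y z} → Triangle x y z → Candidate x → Candidate y → Candidate z → Hits x y z
    all-three {x} {y} {z} tr@(xy , xz , yz) cx cy cz with Fin.<-cmp x y | Fin.<-cmp y z | Fin.<-cmp x z
    ... | tri≈ _ x≡y _ | _ | _ = contradiction x≡y (~-irrefl xy)
    ... | _ | tri≈ _ y≡z _ | _ = contradiction y≡z (~-irrefl yz)
    ... | _ | _ | tri≈ _ x≡z _ = contradiction x≡z (~-irrefl xz)
    ... | _ | tri< y<z _ _ | tri< x<z _ _ = first-two tr cx cy λ _ → x<z , y<z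
    ... | tri> _ _ y<x | _ | tri> _ _ z<x = turn (first-two (rotate tr) cy cz λ _ → y<x , z<x)
    ... | tri< x<y _ _ | tri> _ _ z<y | _ = turn (turn (first-two (rotate (rotate tr)) cz cx λ _ → z<y , x<y))
    ... | tri> _ _ y<x | tri> _ _ z<y | tri< x<z _ _ = contradiction (Fin.<-trans z<y y<x) (Fin.<-asym x<z)
    ... | tri< x<y _ _ | tri< y<z _ _ | tri> _ _ z<x = contradiction (Fin.<-trans x<y y<z) (Fin.<-asym z<x)

    hit : ∀ {x y z} → Triangle x y z → Hits x y z
    hit {x} {y} {z} tr with inDiamond? x
    ... | yes d = [ inj₁ ∘ inj₁ , [ inj₂ ∘ inj₁ ∘ inj₁ , inj₂ ∘ inj₂ ∘ inj₁ ]′ ]′ (diamond-triangle d tr)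
    ... | no ¬d with candidate? x | candidate? y | candidate? z
    ... | yes cx | yes cy | yes cz = all-three tr cx cy cz
    ... | yes cx | yes cy | no ¬cz = first-two tr cx cy λ cz → contradiction cz ¬cz
    ... | no ¬cx | yes cy | yes cz = turn (first-two (rotate tr) cy cz λ cx → contradiction cx ¬cx)
    ... | yes cx | no ¬cy | yes cz = turn (turn (first-two (rotate (rotate tr)) cz cx λ cy → contradiction cy ¬cy))
    ... | yes cx | no ¬cy | no ¬cz = inj₁ (rigid tr cx ¬cy ¬cz)
    ... | no ¬cx | yes cy | no ¬cz = inj₂ (inj₁ (rigid (rotate tr) cy ¬cz ¬cx))
    ... | no ¬cx | no ¬cy | yes cz = inj₂ (inj₂ (rigid (rotate (rotate tr)) cz ¬cx ¬cy))
    ... | no ¬cx | no ¬cy | no ¬cz = ⊥-elim ([ ¬cx , [ ¬cy , ¬cz ]′ ]′ (candidate-exists tr ¬d))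

    free : ∀ {x y} → Chosen x → Chosen y → Flexible x → Flexible y → ¬ Conflict x y
    free (inj₂ (_ , inj₁ ¬f)) _ f _ _ = ¬f f
    free _ (inj₂ (_ , inj₁ ¬f)) _ f _ = ¬f f
    free (inj₁ l) _ _ _ (_ , _ , um , _ , ¬um , _) = ¬um (centre-mate (leader⇒centre l) um)
    free (inj₂ _) (inj₁ l) _ _ (_ , _ , _ , vm , _ , ¬vm , _) = ¬vm (centre-mate (leader⇒centre l) vm)
    free (inj₂ (cx , inj₂ ((_ , xv) , tx))) (inj₂ (cy , inj₂ ((_ , yw) , ty))) _ _ xy =
      conflict-≢ xv yw (cx , cy , xy) (trans tx (sym ty))

  -- Opening the cycles through flexible triangles

  -- A set of cycles of G − D: each vertex has exactly two neighbours outside D, both in K.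
  Cyclic : Subset (n G) → Subset (n G) → Set
  Cyclic D K = ∀ u → u ∈ K → u ∉ D × (∀ v → u ~ v → v ∉ D → v ∈ K) × Two K u

  cyclic? : ∀ D K → Dec (Cyclic D K)
  cyclic? D K = all? λ u → u ∈? K →-dec ¬? (u ∈? D) ×-dec
    (all? λ v → u ~? v →-dec ¬? (v ∈? D) →-dec v ∈? K) ×-dec two? K u

  module _ {D : Subset (n G)} (valid : Valid D) where
    open Valid valid

    -- This is the degree bound in G - D: three neighbours off `D` would be all neighbours of `u`,
    -- but the triangle at `u` has a vertex in `D`.
    avoiding-two : ∀ {u p q r} → u ∉ D → p ∉ D → q ∉ D → r ∉ D → p ≢ q → u ~ p → u ~ q → u ~ r → r ≡ p ⊎ r ≡ q
    avoiding-two {u} {p} {q} {r} u∉ p∉ q∉ r∉ p≢q up uq ur with r ≟ p | r ≟ q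
    ... | yes e | _ = inj₁ e
    ... | _ | yes e = inj₂ e
    ... | no r≢p | no r≢q with deg3⇒inTri (p , q , r , p≢q , r≢p ∘ sym , r≢q ∘ sym , up , uq , ur)
    ... | s , t , tr@(us , ut , st) with hit tr
    ... | inj₁ u∈ = contradiction u∈ u∉
    ... | inj₂ st∈ = ⊥-elim ([ avoid us , avoid ut ]′ st∈)
      where
      avoid : ∀ {s} → u ~ s → s ∉ D
      avoid us s∈ with third p≢q (r≢p ∘ sym) (r≢q ∘ sym) up uq ur us
      ... | inj₁ refl = p∉ s∈
      ... | inj₂ (inj₁ refl) = q∉ s∈
      ... | inj₂ (inj₂ refl) = r∉ s∈

    -- By the degree bound, two neighbours in `A` are already all neighbours off `D`. So what
    -- peeling leaves over is cyclic.
    two⇒cyclic : ∀ {A} → (∀ {u} → u ∈ A → u ∉ D) → (∀ {u} → u ∈ A → Two A u) → Cyclic D A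
    two⇒cyclic avoid two u u∈ = avoid u∈ , closed , two u∈
      where
      closed : ∀ v → u ~ v → v ∉ D → v ∈ _
      closed v uv v∉ with two u∈
      ... | p , q , p≢q , (up , p∈) , (uq , q∈) with avoiding-two (avoid u∈) (avoid p∈) (avoid q∈) v∉ p≢q up uq uv
      ... | inj₁ refl = p∈
      ... | inj₂ refl = q∈

    cyclic-outer : ∀ {K x y z} → Cyclic D K → Triangle x y z → x ∈ D → y ∈ K →
      ∃ λ m → y ~ m × m ∈ K × m ≢ x × m ≢ z
    cyclic-outer {z = z} cyc tr x∈ y∈ with proj₂ (proj₂ (cyc _ y∈))
    ... | p , q , p≢q , (yp , p∈) , (yq , q∈) with p ≟ z
    ... | no p≢z = p , yp , p∈ , (λ { refl → proj₁ (cyc _ p∈) x∈ }) , p≢z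
    ... | yes refl = q , yq , q∈ , (λ { refl → proj₁ (cyc _ q∈) x∈ }) , p≢q ∘ sym

    -- Moving D from x to y opens every cycle of K through the triangle at y. It closes no new one:
    -- a cycle through z and x would have to leave z along K and could never return.
    switch : ∀ {K x y z} → Cyclic D K → Triangle x y z → x ∈ D → y ∈ K → z ∈ K → Candidate y →
      ∃ λ D′ → Valid D′ × (∀ {W} → Cyclic D′ W → Cyclic D W × y ∉ W × z ∉ W)
    switch {K} {x} {y} {z} cyc tr@(xy , xz , yz) x∈ y∈ z∈ cy@(_ , ¬dy , ¬ty) = D′ , valid′ , λ cycW → keeps cycW , out cycW
      where
      y∉ : y ∉ D
      y∉ = proj₁ (cyc y y∈)
      z∉ : z ∉ D
      z∉ = proj₁ (cyc z z∈)
      x∉K : x ∉ K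
      x∉K x∈K = proj₁ (cyc x x∈K) x∈
      tr-y : Triangle y x z
      tr-y = flip (rotate tr)
      ¬dx : ¬ InDiamond x
      ¬dx = ¬inDiamond-mate ¬dy (triangle⇒mate tr-y)

      outer = cyclic-outer cyc tr x∈ y∈
      m = proj₁ outer
      ym = proj₁ (proj₂ outer)
      m∈ = proj₁ (proj₂ (proj₂ outer))
      m≢x = proj₁ (proj₂ (proj₂ (proj₂ outer)))
      m≢z = proj₂ (proj₂ (proj₂ (proj₂ outer)))
      ¬mate-m : ¬ Mate y m
      ¬mate-m mt = [ m≢x , m≢z ]′ (mates ¬dy tr-y mt)
      -- `y` is not tight. The low degree of `m` makes it a dead end as soon as `y` belongs to `D′`.
      ¬3m : ¬ Deg3 m
      ¬3m 3m = ¬ty (m , ym , ¬mate-m , 3m)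
      nbr-y : ∀ {v} → y ~ v → v ≡ x ⊎ v ≡ z ⊎ v ≡ m
      nbr-y = third (~-irrefl xz) (m≢x ∘ sym) (m≢z ∘ sym) (~-sym xy) yz ym

      member? : ∀ v → Dec (v ≡ y ⊎ v ∈ D × v ≢ x)
      member? v = v ≟ y ⊎-dec v ∈? D ×-dec ¬? (v ≟ x)
      D′ : Subset (n G)
      D′ = ⟦ member? ⟧
      y∈′ : y ∈ D′
      y∈′ = ∈⟦⟧⁺ member? (inj₁ refl)
      keep : ∀ {v} → v ∈ D → v ≢ x → v ∈ D′
      keep v∈ v≢x = ∈⟦⟧⁺ member? (inj₂ (v∈ , v≢x))
      ∉′ : ∀ {v} → v ∉ D → v ≢ y → v ∉ D′
      ∉′ v∉ v≢y v∈′ with ∈⟦⟧⁻ member? v∈′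
      ... | inj₁ v≡y = v≢y v≡y
      ... | inj₂ (v∈ , _) = v∉ v∈
      x∉′ : x ∉ D′
      x∉′ x∈′ with ∈⟦⟧⁻ member? x∈′
      ... | inj₁ x≡y = ~-irrefl xy x≡y
      ... | inj₂ (_ , x≢x) = x≢x refl

      y-alone : ∀ {v} → v ∈ D → v ≢ x → ¬ Mate y v
      y-alone v∈ v≢x mt with mates ¬dy tr-y mt
      ... | inj₁ v≡x = v≢x v≡x
      ... | inj₂ refl = z∉ v∈

      -- A conflict at `y` passes through `m`, but all neighbours of `m` are on `K`, hence off `D`.
      y-free : ∀ {v} → v ∈ D → ¬ Conflict y v
      y-free {v} v∈ (y≢v , m′ , ym′ , vm′ , ¬m′ , _) with outer-unique (x , z , tr-y) ym ¬mate-m ym′ ¬m′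
      ... | refl with proj₂ (proj₂ (cyc m m∈))
      ... | p , q , p≢q , (mp , p∈) , (mq , q∈) with two-nbrs ¬3m p≢q mp mq (~-sym vm′)
      ... | inj₁ refl = proj₁ (cyc _ p∈) v∈
      ... | inj₂ refl = proj₁ (cyc _ q∈) v∈

      valid′ : Valid D′
      valid′ = record { kind = kind′ ∘ ∈⟦⟧⁻ member? ; apart = λ a b → apart′ (∈⟦⟧⁻ member? a) (∈⟦⟧⁻ member? b)
                      ; hit = hit′ ; free = λ a b → free′ (∈⟦⟧⁻ member? a) (∈⟦⟧⁻ member? b) }
        where
        kind′ : ∀ {v} → v ≡ y ⊎ v ∈ D × v ≢ x → Candidate v ⊎ Leader v
        kind′ (inj₁ refl) = inj₁ cy
        kind′ (inj₂ (v∈ , _)) = kind v∈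
        apart′ : ∀ {u v} → u ≡ y ⊎ u ∈ D × u ≢ x → v ≡ y ⊎ v ∈ D × v ≢ x → ¬ Mate u v
        apart′ (inj₁ refl) (inj₁ refl) mt = mate-irrefl mt
        apart′ (inj₁ refl) (inj₂ (v∈ , v≢x)) mt = y-alone v∈ v≢x mt
        apart′ (inj₂ (u∈ , u≢x)) (inj₁ refl) mt = y-alone u∈ u≢x (mate-sym mt)
        apart′ (inj₂ (u∈ , _)) (inj₂ (v∈ , _)) mt = apart u∈ v∈ mt
        free′ : ∀ {u v} → u ≡ y ⊎ u ∈ D × u ≢ x → v ≡ y ⊎ v ∈ D × v ≢ x → Flexible u → Flexible v → ¬ Conflict u v
        free′ (inj₁ refl) (inj₁ refl) _ _ (y≢y , _) = y≢y refl
        free′ (inj₁ refl) (inj₂ (v∈ , _)) _ _ co = y-free v∈ co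
        free′ (inj₂ (u∈ , _)) (inj₁ refl) _ _ co = y-free u∈ (conflict-sym co)
        free′ (inj₂ (u∈ , _)) (inj₂ (v∈ , _)) fu fv co = free u∈ v∈ fu fv co
        through-x : ∀ {p q} → Triangle x p q → p ∈ D′ ⊎ q ∈ D′
        through-x {p} {q} t@(xp , xq , pq) with mates ¬dx tr (triangle⇒mate t) | mates ¬dx tr (triangle⇒mate (flip t))
        ... | inj₁ refl | _ = inj₁ y∈′
        ... | _ | inj₁ refl = inj₂ y∈′
        ... | inj₂ refl | inj₂ refl = contradiction refl (~-irrefl pq)
        hit′ : ∀ {p q r} → Triangle p q r → p ∈ D′ ⊎ q ∈ D′ ⊎ r ∈ D′
        hit′ {p} {q} {r} t with p ≟ x | q ≟ x | r ≟ x
        ... | yes refl | _ | _ = inj₂ (through-x t)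
        ... | _ | yes refl | _ = [ inj₂ ∘ inj₂ , inj₁ ]′ (through-x (rotate t))
        ... | _ | _ | yes refl = [ inj₁ , inj₂ ∘ inj₁ ]′ (through-x (rotate (rotate t)))
        ... | no p≢x | no q≢x | no r≢x with hit t
        ... | inj₁ p∈ = inj₁ (keep p∈ p≢x)
        ... | inj₂ (inj₁ q∈) = inj₂ (inj₁ (keep q∈ q≢x))
        ... | inj₂ (inj₂ r∈) = inj₂ (inj₂ (keep r∈ r≢x))

      module _ {W : Subset (n G)} (cycW : Cyclic D′ W) where

        y∉W : y ∉ W
        y∉W y∈W = proj₁ (cycW y y∈W) y∈′

        m∉W : m ∉ W
        m∉W m∈W with proj₂ (proj₂ (cycW m m∈W))
        ... | p , q , p≢q , (mp , p∈) , (mq , q∈) with two-nbrs ¬3m p≢q mp mq (~-sym ym)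
        ... | inj₁ refl = y∉W p∈
        ... | inj₂ refl = y∉W q∈

        z∉W : z ∉ W
        z∉W z∈W with cyclic-outer cyc (flip tr) x∈ z∈
        ... | z′ , zz′ , z′∈ , z′≢x , z′≢y =
          -- In `W ∩ K` the vertex `z` keeps only the neighbour `z′`, as `x` is off `K` and `y` off
          -- `W`. Every other vertex keeps both neighbours on `K`, since the neighbours of `y` are
          -- just `x`, `z` and `m`.
          no-single-end (x∈p∩q⁺ (z∈W , z∈)) zz′ (x∈p∩q⁺ (inW z∈W (proj₁ (cyc z′ z′∈)) z′≢y zz′ , z′∈)) end pass
          where
          inW : ∀ {u v} → u ∈ W → v ∉ D → v ≢ y → u ~ v → v ∈ W
          inW u∈ v∉ v≢y uv = proj₁ (proj₂ (cycW _ u∈)) _ uv (∉′ v∉ v≢y)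
          end : ∀ {v} → z ~ v → v ∈ W ∩ K → v ≡ z′
          end {v} zv v∈ with x∈p∩q⁻ W K v∈
          ... | v∈W , v∈K with third (~-irrefl xy) (z′≢x ∘ sym) (z′≢y ∘ sym) (~-sym xz) (~-sym yz) zz′ zv
          ... | inj₁ refl = contradiction v∈K x∉K
          ... | inj₂ (inj₁ refl) = contradiction v∈W y∉W
          ... | inj₂ (inj₂ e) = e
          pass : ∀ {w} → w ∈ W ∩ K → w ≢ z → ∃₂ λ p q → p ≢ q × (w ~ p × p ∈ W ∩ K) × (w ~ q × q ∈ W ∩ K) ×
            (∀ {v} → w ~ v → v ∈ W ∩ K → v ≡ p ⊎ v ≡ q)
          pass {w} w∈ w≢z with x∈p∩q⁻ W K w∈
          ... | w∈W , w∈K with proj₂ (proj₂ (cyc w w∈K))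
          ... | p , q , p≢q , (wp , p∈) , (wq , q∈) =
            p , q , p≢q , (wp , x∈p∩q⁺ (stays wp p∈ , p∈)) , (wq , x∈p∩q⁺ (stays wq q∈ , q∈)) ,
            λ wv v∈ → avoiding-two (proj₁ (cyc w w∈K)) (proj₁ (cyc p p∈)) (proj₁ (cyc q q∈))
              (proj₁ (cyc _ (proj₂ (x∈p∩q⁻ W K v∈)))) p≢q wp wq wv
            where
            w≁y : ¬ w ~ y
            w≁y wy with nbr-y (~-sym wy)
            ... | inj₁ refl = x∉K w∈K
            ... | inj₂ (inj₁ w≡z) = w≢z w≡z
            ... | inj₂ (inj₂ refl) = m∉W w∈W
            stays : ∀ {v} → w ~ v → v ∈ K → v ∈ W
            stays wv v∈ = inW w∈W (proj₁ (cyc _ v∈)) (λ { refl → w≁y wv }) wv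

        x∉W : x ∉ W
        x∉W x∈W = z∉W (proj₁ (proj₂ (cycW x x∈W)) z xz (∉′ z∉ (~-irrefl yz ∘ sym)))

        out : y ∉ W × z ∉ W
        out = y∉W , z∉W

        -- `D` and `D′` differ only in `x` and `y`, and `W` avoids `x` and every neighbour of `y`.
        keeps : Cyclic D W
        keeps w w∈ = w∉ , closed , proj₂ (proj₂ (cycW w w∈))
          where
          w∉ : w ∉ D
          w∉ w∈D = proj₁ (cycW w w∈) (keep w∈D λ { refl → x∉W w∈ })
          w≁y : ¬ w ~ y
          w≁y wy with nbr-y (~-sym wy)
          ... | inj₁ refl = x∉W w∈
          ... | inj₂ (inj₁ refl) = z∉W w∈
          ... | inj₂ (inj₂ refl) = m∉W w∈
          closed : ∀ v → w ~ v → v ∉ D → v ∈ W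
          closed v wv v∉ = proj₁ (proj₂ (cycW w w∈)) v wv (∉′ v∉ λ { refl → w≁y wv })

    -- The triangle at `t` consists of a vertex of `D` and an edge of the cycle. One of the two
    -- candidates is not in `D`, so it is an end of that edge, and switching to either end removes
    -- `t` from all cycles.
    open-cycle : ∀ {K t} → Cyclic D K → t ∈ K → Flexible t →
      ∃ λ D′ → Valid D′ × (∀ {W} → Cyclic D′ W → Cyclic D W × t ∉ W)
    open-cycle {K} {t} cyc t∈ (c , c′ , c≢c′ , (cc , nc) , (cc′ , nc′)) = go (proj₂ (proj₂ t-inTri))
      where
      t∉ : t ∉ D
      t∉ = proj₁ (cyc t t∈)
      t-inTri : InTri t
      t-inTri = [ (λ e → subst InTri (sym e) (proj₁ cc)) , mate⇒inTri ]′ nc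
      ¬dt : ¬ InDiamond t
      ¬dt = [ (λ e → subst (λ v → ¬ InDiamond v) (sym e) ¬dc) , ¬inDiamond-mate ¬dc ∘ mate-sym ]′ nc
        where
        ¬dc = proj₁ (proj₂ cc)

      at : ∀ {x r} → Triangle t x r → x ∈ D → ∃ λ D′ → Valid D′ × (∀ {W} → Cyclic D′ W → Cyclic D W × t ∉ W)
      at {x} {r} tr@(tx , ty , xr) x∈ = move other
        where
        r∈ : r ∈ K
        r∈ = proj₁ (proj₂ (cyc t t∈)) r ty λ r∈D → apart x∈ r∈D (triangle⇒mate (rotate tr))
        pick : ∀ {e} → e ≢ x → Candidate e → Near t e → Candidate t ⊎ Candidate r
        pick e≢x ce ne with near ¬dt tr ne
        ... | inj₁ refl = inj₁ ce
        ... | inj₂ (inj₁ e≡x) = contradiction e≡x e≢x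
        ... | inj₂ (inj₂ refl) = inj₂ ce
        other : Candidate t ⊎ Candidate r
        other with c ≟ x
        ... | no c≢x = pick c≢x cc nc
        ... | yes refl = pick (c≢c′ ∘ sym) cc′ nc′
        move : Candidate t ⊎ Candidate r → ∃ λ D′ → Valid D′ × (∀ {W} → Cyclic D′ W → Cyclic D W × t ∉ W)
        move (inj₁ ct) with switch cyc (flip (rotate tr)) x∈ t∈ r∈ ct
        ... | D′ , v′ , less = D′ , v′ , λ cycW → proj₁ (less cycW) , proj₁ (proj₂ (less cycW))
        move (inj₂ cr) with switch cyc (rotate tr) x∈ r∈ t∈ cr
        ... | D′ , v′ , less = D′ , v′ , λ cycW → proj₁ (less cycW) , proj₂ (proj₂ (less cycW))

      go : ∀ {p q} → Triangle t p q → ∃ λ D′ → Valid D′ × (∀ {W} → Cyclic D′ W → Cyclic D W × t ∉ W)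
      go tr with hit tr
      ... | inj₁ t∈D = contradiction t∈D t∉
      ... | inj₂ (inj₁ p∈) = at tr p∈
      ... | inj₂ (inj₂ q∈) = at (flip tr) q∈

  Rigid : Subset (n G) → Set
  Rigid D = ∀ {K t} → Cyclic D K → t ∈ K → ¬ Flexible t

  -- One pass over the vertices suffices: a switch creates no cyclic set, so vertices already
  -- treated stay off all cycles.
  rigid-exists : ∃ λ D → Valid D × Rigid D
  rigid-exists with go (allFin (n G))
    where
    go : ∀ ts → ∃ λ D → Valid D × (∀ {K t} → Cyclic D K → t ∈ˡ ts → t ∈ K → ¬ Flexible t)
    go [] = proj₁ valid-exists , proj₂ valid-exists , λ _ ()
    go (t ∷ ts) with go ts
    ... | D , valid , done with anySubset? (λ K → cyclic? D K ×-dec t ∈? K ×-dec flexible? t)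
    ... | no none = D , valid , λ { cyc (here refl) t∈ f → none (_ , cyc , t∈ , f) ; cyc (there s∈) → done cyc s∈ }
    ... | yes (K , cyc , t∈ , f) with open-cycle valid cyc t∈ f
    ... | D′ , valid′ , less = D′ , valid′ , λ
      { cycW (here refl) t∈W _ → proj₂ (less cycW) t∈W
      ; cycW (there s∈) → done (proj₁ (less cycW)) s∈ }
  ... | D , valid , rigid = D , valid , λ cyc t∈ → rigid cyc (∈-allFin _) t∈

  -- Even cycles

  -- A laced vertex has its cycle in G − D alternate between edges of triangles and edges joining
  -- two triangles, so that cycle is even.
  Laced : V G → Set
  Laced u = ¬ InDiamond u × ∃₂ λ v w → Triangle u v w × Tight u × Tight v × Candidate w

  laced? : ∀ u → Dec (Laced u)
  laced? u = ¬? (inDiamond? u) ×-dec any? λ v → any? λ w →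
    (u ~? v ×-dec u ~? w ×-dec v ~? w) ×-dec tight? u ×-dec tight? v ×-dec candidate? w

  laced-mate : ∀ {u} → Laced u → ∃ λ v → Mate u v × Laced v
  laced-mate (¬d , v , w , tr@(uv , uw , vw) , tu , tv , cw) =
    v , triangle⇒mate tr , ¬inDiamond-mate ¬d (triangle⇒mate tr) , _ , w , (~-sym uv , vw , uw) , tv , tu , cw

  -- Edges between laced vertices form two matchings. Inside a triangle the third vertex is a
  -- candidate, so not tight and not laced; outside, a vertex of a triangle has at most one further
  -- neighbour. Every laced vertex has a laced mate, as the colouring of the second matching
  -- requires.
  laced-colouring : ∀ {A} → (∀ {u} → u ∈ A → Laced u) → Colourable A
  laced-colouring {A} laced with TwoMatchings.colour-two-matchings mate-matching outer-matching
    where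
    mate-matching : TwoMatchings.Matching (λ u v → Mate u v × Laced u × Laced v)
    mate-matching = record
      { decide = λ u v → mate? u v ×-dec laced? u ×-dec laced? v
      ; symmetric = λ (uv , lu , lv) → mate-sym uv , lv , lu
      ; irreflexive = mate-irrefl ∘ proj₁
      ; functional = λ (uv , lu , lv) (uw , _ , lw) → trans (partner lu uv lv) (sym (partner lu uw lw)) }
      where
      partner : ∀ {u v} (lu : Laced u) → Mate u v → Laced v → v ≡ proj₁ (proj₂ lu)
      partner (¬d , p , q , tr , _ , _ , (_ , _ , ¬tq)) uv (_ , _ , _ , _ , tv , _) with mates ¬d tr uv
      ... | inj₁ v≡p = v≡p
      ... | inj₂ refl = contradiction tv ¬tq
    outer-matching : TwoMatchings.Matching (λ u v → (u ~ v × ¬ Mate u v) × InTri u × InTri v)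
    outer-matching = record
      { decide = λ u v → (u ~? v ×-dec ¬? (mate? u v)) ×-dec inTri? u ×-dec inTri? v
      ; symmetric = λ ((uv , ¬m) , iu , iv) → (~-sym uv , ¬m ∘ mate-sym) , iv , iu
      ; irreflexive = λ ((uu , _) , _) → ~-irrefl uu refl
      ; functional = λ ((uv , ¬uv) , iu , _) ((uw , ¬uw) , _) → outer-unique iu uv ¬uv uw ¬uw }
  ... | c , mate-≢ , outer-≢ = c , λ u∈ v∈ → proper (laced u∈) (laced v∈)
    where
    inTri : ∀ {u} → Laced u → InTri u
    inTri (_ , v , w , tr , _) = v , w , tr
    proper : ∀ {u v} → Laced u → Laced v → u ~ v → c u ≢ c v
    proper {u} {v} lu lv uv with mate? u v
    ... | yes m = mate-≢ (m , lu , lv)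
    ... | no ¬m with laced-mate lu | laced-mate lv
    ... | u′ , uu′ , lu′ | v′ , vv′ , lv′ =
      outer-≢ (uu′ , lu , lu′) (vv′ , lv , lv′) ((uv , ¬m) , inTri lu , inTri lv)

  -- Conflicts and the fourth colour

  -- The vertices of D which leave the third colour class because of a conflict.
  Bumped : V G → Set
  Bumped u = Candidate u × ¬ Flexible u × ∃ λ z → Candidate z × Conflict u z × (Flexible z ⊎ u Fin.< z)

  bumped? : ∀ u → Dec (Bumped u)
  bumped? u = candidate? u ×-dec ¬? (flexible? u) ×-dec
    any? λ z → candidate? z ×-dec conflict? u z ×-dec (flexible? z ⊎-dec u <? z)

  bumped-deg3 : ∀ {u} → Bumped u → Deg3 u
  bumped-deg3 ((i , _) , _ , _ , _ , (_ , _ , um , _ , ¬um , _) , _) = deg3-by-outer i um ¬um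

  rigid-mate-not-candidate : ∀ {u v} → Candidate u → ¬ Flexible u → Mate u v → ¬ Candidate v
  rigid-mate-not-candidate cu ¬f m cv = ¬f (_ , _ , ~-irrefl (proj₁ m) , (cu , inj₁ refl) , (cv , inj₂ m))

  rigid-mate-tight : ∀ {u v} → Candidate u → ¬ Flexible u → Mate u v → Tight v
  rigid-mate-tight cu@(_ , ¬d , _) ¬f m =
    not-candidate⇒tight (mate⇒inTri (mate-sym m)) (¬inDiamond-mate ¬d m) (rigid-mate-not-candidate cu ¬f m)

  -- With `u` as the only candidate, its two mates are tight. All three vertices of the triangle
  -- have degree 3, `u` because the conflict gives it an outer neighbour.
  bumped-mate-heavy : ∀ {u v} → Bumped u → Mate u v → IsHeavy v
  bumped-mate-heavy bu@(cu , ¬f , _) m@(uv , w , uw , vw) =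
    tight⇒heavy (~-sym uv , vw , uw) (rigid-mate-tight cu ¬f m) (bumped-deg3 bu)
      (tight⇒deg3 (mate⇒inTri (mate-sym m′)) (rigid-mate-tight cu ¬f m′))
    where
    m′ = uw , _ , uv , ~-sym vw

  -- The two mates of a bumped vertex are heavy and adjacent.
  no-bumped : Saturated3 G 0 → ∀ {u} → ¬ Bumped u
  no-bumped sat₀ bu@((( _ , _ , tr@(up , uq , pq)) , _) , _) =
    contradiction (heavy-nbrs sat₀ (bumped-mate-heavy bu (triangle⇒mate tr)) ([] ∷ [])
      ((pq , bumped-mate-heavy bu (triangle⇒mate (flip tr))) ∷ [])) λ ()

  module _ {u v : V G} (bu : Bumped u) (bv : Bumped v) (u≢v : u ≢ v) where
    private
      cu = proj₁ bu
      cv = proj₁ bv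
      ¬fu = proj₁ (proj₂ bu)

    bumped-far₁ : ¬ u ~ v
    bumped-far₁ uv = rigid-mate-not-candidate cu ¬fu (candidate-deg3-nbr⇒mate cu uv (bumped-deg3 bv)) cv

    -- A middle vertex of degree 3 would put both in one triangle. Otherwise they are in conflict
    -- with each other and with nothing else, and comparing indices bumps only one of them.
    bumped-far₂ : ∀ {w} → u ~ w → ¬ w ~ v
    bumped-far₂ {w} uw wv with deg3? w
    ... | yes 3w with candidate-deg3-nbr⇒mate cu uw 3w | candidate-deg3-nbr⇒mate cv (~-sym wv) 3w
    ...   | m@(_ , t , ut , wt) | m′ with mates (¬inDiamond-mate (proj₁ (proj₂ cu)) m) (~-sym uw , wt , ut) (mate-sym m′)
    ...     | inj₁ v≡u = u≢v (sym v≡u)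
    ...     | inj₂ refl = bumped-far₁ ut
    bumped-far₂ {w} uw wv | no ¬3 = clash (proj₂ (proj₂ bu)) (proj₂ (proj₂ bv))
      where
      outer : ∀ {x} → Bumped x → x ~ w → ¬ Mate x w
      outer bx xw (_ , t , xt , wt) = ¬3 (IsHeavy.deg3 (bumped-mate-heavy bx (xw , t , xt , wt)))
      co : Conflict u v
      co = u≢v , w , uw , ~-sym wv , outer bu uw , outer bv (~-sym wv) , ¬3
      clash : (∃ λ z → Candidate z × Conflict u z × (Flexible z ⊎ u Fin.< z)) →
              (∃ λ z → Candidate z × Conflict v z × (Flexible z ⊎ v Fin.< z)) → ⊥
      clash (_ , _ , uz , lt) (_ , _ , vz , lt′) with conflict-unique cu co uz | conflict-unique cv (conflict-sym co) vz | lt | lt′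
      ... | refl | refl | inj₁ f | _ = proj₁ (proj₂ bv) f
      ... | refl | refl | _ | inj₁ f = ¬fu f
      ... | refl | refl | inj₂ u<v | inj₂ v<u = Fin.<-asym u<v v<u

  -- `w` is the middle of the conflict that bumped `u`, so `w′` is the other candidate of that
  -- conflict.
  bumped-outer : ∀ {u w w′} → Bumped u → u ~ w → ¬ Mate u w → w ~ w′ → ¬ Deg3 w → w′ ≢ u → Deg3 w′
  bumped-outer ((i , _) , _ , _ , (iz , _) , (u≢z , m , um , zm , ¬um , ¬zm , _) , _) uw ¬uw ww′ ¬3 w′≢u
    with outer-unique i um ¬um uw ¬uw
  ... | refl with two-nbrs ¬3 u≢z (~-sym um) (~-sym zm) ww′
  ... | inj₁ w′≡u = contradiction w′≡u w′≢u
  ... | inj₂ refl = deg3-by-outer iz zm ¬zm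

  -- If `w` and `w′` are both mates of the ends, then `w` is heavy with heavy neighbours `w′` and
  -- the other mate `t` of `u`; so `w′` is `t` and the distance is already 2. In the remaining cases
  -- an inner vertex of degree 3 is an outer neighbour of `u` or `v`, which makes that end tight.
  bumped-far₃ : ∀ {u v w w′} → Bumped u → Bumped v → u ≢ v → u ~ w → w ~ w′ → ¬ w′ ~ v
  bumped-far₃ {u} {v} {w} {w′} bu bv u≢v uw ww′ w′v with mate? u w | mate? v w′
  ... | yes m@(_ , t , ut , wt) | yes m′ = bumped-far₂ bu bv u≢v ut
        (subst (_~ v) (heavy-nbr-unique (heavy m) (bumped-mate-heavy bv m′) (bumped-mate-heavy bu (ut , w , uw , ~-sym wt)) ww′ wt) w′v)
    where
    heavy : Mate u w → IsHeavy w
    heavy = bumped-mate-heavy bu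
  ... | yes m | no ¬m′ = ¬m′ (candidate-deg3-nbr⇒mate (proj₁ bv) (~-sym w′v) (IsHeavy.nbrs-deg3 (bumped-mate-heavy bu m) ww′))
  ... | no ¬m | yes m′ = ¬m (candidate-deg3-nbr⇒mate (proj₁ bu) uw (IsHeavy.nbrs-deg3 (bumped-mate-heavy bv m′) (~-sym ww′)))
  ... | no ¬m | no ¬m′ with deg3? w | w′ ≟ u
  ... | yes 3w | _ = ¬m (candidate-deg3-nbr⇒mate (proj₁ bu) uw 3w)
  ... | no _ | yes refl = bumped-far₁ bu bv u≢v w′v
  ... | no ¬3 | no w′≢u = ¬m′ (candidate-deg3-nbr⇒mate (proj₁ bv) (~-sym w′v) (bumped-outer bu uw ¬m ww′ ¬3 w′≢u))

  bumped-far : ∀ {u v} → Bumped u → Bumped v → u ≢ v → ¬ DistLe G u v 3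
  bumped-far bu bv u≢v (_ , _ , here) = u≢v refl
  bumped-far bu bv u≢v (_ , _ , step uv here) = bumped-far₁ bu bv u≢v uv
  bumped-far bu bv u≢v (_ , _ , step uw (step wv here)) = bumped-far₂ bu bv u≢v uw wv
  bumped-far bu bv u≢v (_ , _ , step uw (step ww′ (step w′v here))) = bumped-far₃ bu bv u≢v uw ww′ w′v
  bumped-far bu bv u≢v (_ , s≤s (s≤s (s≤s ())) , step _ (step _ (step _ (step _ _))))

  -- All neighbours of a leader are its mates, so `v` and `c` would share `a` or `b`, which have no
  -- neighbours outside the diamond.
  leader-off-end : ∀ {a b c d v} → Diamond a b c d → Leader a → Leader v → a ≢ v → ¬ v ~ c
  leader-off-end {a} {b} {v = v} dia la lv a≢v vc with centre-mate (leader⇒centre lv) vc | v ≟ b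
  ... | _ | yes refl = leaders-apart la lv (Diamond.ab dia)
  ... | (_ , s , vs , cs) | no v≢b with third (~-irrefl (Diamond.ab dia)) a≢v (v≢b ∘ sym) (~-sym (Diamond.ac dia)) (~-sym (Diamond.bc dia)) (~-sym vc) cs
  ... | inj₁ refl = leaders-apart lv la vs
  ... | inj₂ (inj₂ refl) = ~-irrefl vs refl
  ... | inj₂ (inj₁ refl) with Diamond.nbr (Diamond.swap-centres dia) (~-sym vs)
  ... | inj₁ v≡a = a≢v (sym v≡a)
  ... | inj₂ (inj₁ refl) = ~-irrefl vc refl
  ... | inj₂ (inj₂ refl) = leaders-apart la lv (Diamond.ad dia)

  leaders-far : ∀ {u v w} → u ≢ v → Leader u → Leader v → u ~ w → ¬ v ~ w
  leaders-far u≢v lu lv uw vw with twin⇒diamond (proj₁ (proj₂ lu))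
  ... | c , d , dia with Diamond.nbr dia uw
  ... | inj₂ (inj₁ refl) = leader-off-end dia lu lv u≢v vw
  ... | inj₂ (inj₂ refl) = leader-off-end (Diamond.swap-ends dia) lu lv u≢v vw
  ... | inj₁ refl with Diamond.nbr (Diamond.swap-centres dia) (~-sym vw)
  ... | inj₁ v≡u = u≢v (sym v≡u)
  ... | inj₂ (inj₁ refl) = leaders-apart lu lv (Diamond.ac dia)
  ... | inj₂ (inj₂ refl) = leaders-apart lu lv (Diamond.ad dia)

  -- The third colour class and the remaining cycles

  module _ {D : Subset (n G)} (valid : Valid D) (rigid : Rigid D) where
    open Valid valid

    nonadjacent : ∀ {u v} → u ∈ D → v ∈ D → ¬ u ~ v
    nonadjacent {u} {v} u∈ v∈ uv with kind u∈ | kind v∈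
    ... | inj₂ lu | _ = apart u∈ v∈ (centre-mate (leader⇒centre lu) uv)
    ... | _ | inj₂ lv = apart v∈ u∈ (centre-mate (leader⇒centre lv) (~-sym uv))
    ... | inj₁ cu | inj₁ (iv , _) with mate? u v
    ... | yes m = apart u∈ v∈ m
    ... | no ¬m = ¬m (candidate-deg3-nbr⇒mate cu uv (deg3-by-outer iv (~-sym uv) (¬m ∘ mate-sym)))

    kind⇒inTri : ∀ {u} → Candidate u ⊎ Leader u → InTri u
    kind⇒inTri (inj₁ (i , _)) = i
    kind⇒inTri (inj₂ (_ , (uv , c , _ , _ , (uc , vc) , _) , _)) = _ , c , uv , uc , vc

    -- If `w` is a mate of exactly one of the two, it has degree 3 and the other would be tight. If
    -- it is a mate of both candidates, they share a triangle. If it is a mate of neither, they are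
    -- in conflict, so `free` or the comparison of indices applies.
    unbumped-far : ∀ {u v w} → u ∈ D → v ∈ D → ¬ Bumped u → ¬ Bumped v → u ≢ v → u ~ w → ¬ v ~ w
    unbumped-far {u} {v} {w} u∈ v∈ ¬bu ¬bv u≢v uw vw = go (kind u∈) (kind v∈)
      where
      same : Candidate u → Mate u w → Mate v w → ⊥
      same (_ , ¬d , _) m@(_ , t , ut , wt) m′ with mates (¬inDiamond-mate ¬d m) (~-sym uw , wt , ut) (mate-sym m′)
      ... | inj₁ v≡u = u≢v (sym v≡u)
      ... | inj₂ refl = nonadjacent u∈ v∈ ut

      half : ∀ {x y} → Candidate x ⊎ Leader x → x ~ w → ¬ Mate x w → Mate y w → ⊥
      half (inj₂ l) xw ¬m _ = ¬m (centre-mate (leader⇒centre l) xw)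
      half (inj₁ c) xw ¬m m = ¬m (candidate-deg3-nbr⇒mate c xw
        (deg3-by-outer (mate⇒inTri (mate-sym m)) (~-sym xw) (¬m ∘ mate-sym)))

      clash : Candidate u → Candidate v → Conflict u v → ⊥
      clash cu cv co with flexible? u | flexible? v
      ... | yes fu | yes fv = free u∈ v∈ fu fv co
      ... | no ¬fu | yes fv = ¬bu (cu , ¬fu , v , cv , co , inj₁ fv)
      ... | yes fu | no ¬fv = ¬bv (cv , ¬fv , u , cu , conflict-sym co , inj₁ fu)
      ... | no ¬fu | no ¬fv with Fin.<-cmp u v
      ... | tri< u<v _ _ = ¬bu (cu , ¬fu , v , cv , co , inj₂ u<v)
      ... | tri≈ _ u≡v _ = u≢v u≡v
      ... | tri> _ _ v<u = ¬bv (cv , ¬fv , u , cu , conflict-sym co , inj₂ v<u)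

      go : Candidate u ⊎ Leader u → Candidate v ⊎ Leader v → ⊥
      go ku kv with mate? u w | mate? v w
      go ku kv | yes m | no ¬m = half kv vw ¬m m
      go ku kv | no ¬m | yes m = half ku uw ¬m m
      go (inj₂ lu) (inj₂ lv) | _ | _ = leaders-far u≢v lu lv uw vw
      go (inj₁ cu) _ | yes m | yes m′ = same cu m m′
      go (inj₂ lu) (inj₁ (_ , ¬d , _)) | yes m | yes m′ =
        ¬d (inDiamond-mate (inDiamond-mate (centre⇒inDiamond (leader⇒centre lu)) m) (mate-sym m′))
      go (inj₂ lu) (inj₁ _) | no ¬m | no _ = ¬m (centre-mate (leader⇒centre lu) uw)
      go (inj₁ _) (inj₂ lv) | no _ | no ¬m = ¬m (centre-mate (leader⇒centre lv) vw)
      go (inj₁ cu) (inj₁ cv) | no ¬m | no ¬m′ =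
        clash cu cv (u≢v , w , uw , vw , ¬m , ¬m′ , λ 3w → ¬m (candidate-deg3-nbr⇒mate cu uw 3w))

    module _ {K : Subset (n G)} (cyc : Cyclic D K) where

      off : ∀ {u} → u ∈ K → u ∉ D
      off u∈ = proj₁ (cyc _ u∈)

      stay : ∀ {u v} → u ∈ K → u ~ v → v ∉ D → v ∈ K
      stay u∈ uv v∉ = proj₁ (proj₂ (cyc _ u∈)) _ uv v∉

      -- By rigidity the vertex of the triangle in `D` is its only candidate, so the other two are
      -- tight.
      triangle⇒laced : ∀ {t} → t ∈ K → InTri t → ¬ InDiamond t → Laced t
      triangle⇒laced {t} t∈ (p , q , tr) ¬d = go (hit tr)
        where
        laced : ∀ {p q} → Triangle t p q → q ∈ D → Laced t
        laced {p} {q} tr@(tp , tq , pq) q∈ =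
          ¬d , p , q , tr ,
          not-candidate⇒tight (p , q , tr) ¬d (λ ct → rigid cyc t∈ (t , q , ~-irrefl tq , (ct , inj₁ refl) , (cq , inj₂ tq-mate))) ,
          not-candidate⇒tight (q , t , rotate tr) (¬inDiamond-mate ¬d tp-mate)
            (λ cp → rigid cyc t∈ (p , q , ~-irrefl pq , (cp , inj₂ tp-mate) , (cq , inj₂ tq-mate))) ,
          cq
          where
          tp-mate = triangle⇒mate tr
          tq-mate = triangle⇒mate (flip tr)
          cq = hit-candidate q∈ (¬inDiamond-mate ¬d tq-mate)
        go : t ∈ D ⊎ p ∈ D ⊎ q ∈ D → Laced t
        go (inj₁ t∈D) = contradiction t∈D (off t∈)
        go (inj₂ (inj₁ p∈)) = laced (flip tr) p∈
        go (inj₂ (inj₂ q∈)) = laced tr q∈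

      -- Otherwise the centres and the end v would be heavy.
      diamond-exit : ∀ {a b v d u} → Diamond a b v d → v ∈ K → v ~ u → ¬ Mate v u → ¬ Deg3 u
      diamond-exit {a} {b} {v} {d} {u} dia v∈ vu ¬m 3u with hit (rotate (rotate (triangle dia)))
        where
        triangle : ∀ {a b c d} → Diamond a b c d → Triangle a b c
        triangle dia = Diamond.ab dia , Diamond.ac dia , Diamond.bc dia
      ... | inj₁ v∈D = off v∈ v∈D
      ... | inj₂ ab∈ = [ (λ a∈ → through dia a∈) , (λ b∈ → through (Diamond.swap-centres dia) b∈) ]′ ab∈
        where
        through : ∀ {a b} → Diamond a b v d → a ∈ D → ⊥
        through {a} {b} dia a∈ = ~-irrefl bc (heavy-nbr-unique ha hb hc ab ac)
          where
          open Diamond dia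
          d∈ : d ∈ K
          d∈ = stay (stay v∈ (~-sym bc) (λ b∈ → nonadjacent a∈ b∈ ab)) bd (λ d∈ → nonadjacent a∈ d∈ ad)
          -- The cycle runs through `v`, `b`, `d`, so `d` has two neighbours on it besides `a`.
          3d : Deg3 d
          3d with proj₂ (proj₂ (cyc d d∈))
          ... | p , q , p≢q , (dp , p∈) , (dq , q∈) =
            a , p , q , (λ { refl → off p∈ a∈ }) , (λ { refl → off q∈ a∈ }) , p≢q , ~-sym ad , dp , dq
          a≢u : a ≢ u
          a≢u refl = ¬m (vu , b , ~-sym bc , ab)
          b≢u : b ≢ u
          b≢u refl = ¬m (vu , a , ~-sym ac , ~-sym ab)
          3a : Deg3 a
          3a = b , v , d , ~-irrefl bc , ~-irrefl bd , c≢d , ab , ac , ad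
          3b : Deg3 b
          3b = a , v , d , ~-irrefl ac , ~-irrefl ad , c≢d , ~-sym ab , bc , bd
          3v : Deg3 v
          3v = a , b , u , ~-irrefl ab , a≢u , b≢u , ~-sym ac , ~-sym bc , vu
          ha : IsHeavy a
          ha = mkHeavy 3a λ aw → [ (λ { refl → 3b }) , [ (λ { refl → 3v }) , (λ { refl → 3d }) ]′ ]′ (nbr aw)
          hb : IsHeavy b
          hb = mkHeavy 3b λ bw → [ (λ { refl → 3a }) , [ (λ { refl → 3v }) , (λ { refl → 3d }) ]′ ]′ (Diamond.nbr swap-centres bw)
          hc : IsHeavy v
          hc = mkHeavy 3v λ vw → [ (λ { refl → 3a }) , [ (λ { refl → 3b }) , (λ { refl → 3u }) ]′ ]′
                 (third (~-irrefl ab) a≢u b≢u (~-sym ac) (~-sym bc) vu vw)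

      -- Along a cycle either all vertices are laced or none. On leaving the triangle, tightness of
      -- `u` gives the next vertex degree 3, hence a triangle, and `diamond-exit` excludes a
      -- diamond.
      laced-nbr : ∀ {u v} → u ∈ K → Laced u → u ~ v → v ∈ K → Laced v
      laced-nbr {u} {v} u∈ (¬d , u′ , w , tr , (t , ut , ¬ut , 3t) , _) uv v∈ with mate? u v
      ... | yes m with mates ¬d tr m
      ...   | inj₁ refl = triangle⇒laced v∈ (mate⇒inTri (mate-sym m)) (¬inDiamond-mate ¬d m)
      ...   | inj₂ refl = triangle⇒laced v∈ (mate⇒inTri (mate-sym m)) (¬inDiamond-mate ¬d m)
      laced-nbr {u} {v} u∈ (¬d , u′ , w , tr , (t , ut , ¬ut , 3t) , _) uv v∈
          | no ¬m with outer-unique (_ , _ , tr) uv ¬m ut ¬ut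
      ... | refl = triangle⇒laced v∈ (deg3⇒inTri 3t) ¬dv
        where
        3u : Deg3 u
        3u = deg3-by-outer (_ , _ , tr) uv ¬m
        ¬dv : ¬ InDiamond v
        ¬dv (a , ce , inj₁ refl) = ¬m (mate-sym (centre-mate ce (~-sym uv)))
        ¬dv (a , (b , tw) , inj₂ av) with twin⇒diamond tw
        ... | c , d , dia with Diamond.nbr dia av
        ... | inj₁ refl = ¬m (mate-sym (centre-mate (a , twin-sym tw) (~-sym uv)))
        ... | inj₂ (inj₁ refl) = diamond-exit dia v∈ (~-sym uv) (¬m ∘ mate-sym) 3u
        ... | inj₂ (inj₂ refl) = diamond-exit (Diamond.swap-ends dia) v∈ (~-sym uv) (¬m ∘ mate-sym) 3u

      -- `v` has degree 3, from `u` and its two neighbours on the cycle; as `u` is not tight, `v` is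
      -- a mate.
      candidate-off-unlaced : ∀ {u v} → u ∈ D → Candidate u → u ~ v → v ∈ K → Laced v
      candidate-off-unlaced {u} {v} u∈ cu@(_ , ¬d , _) uv v∈ with mate? u v
      ... | yes m = triangle⇒laced v∈ (mate⇒inTri (mate-sym m)) (¬inDiamond-mate ¬d m)
      ... | no ¬m with proj₂ (proj₂ (cyc v v∈))
      ... | p , q , p≢q , (vp , p∈) , (vq , q∈) = contradiction
        (candidate-deg3-nbr⇒mate cu uv
          (u , p , q , (λ { refl → off p∈ u∈ }) , (λ { refl → off q∈ u∈ }) , p≢q , ~-sym uv , vp , vq)) ¬m

      -- The unlaced part of K, together with its neighbours in D, is a union of components of G.
      Unlaced : V G → Set
      Unlaced v = v ∈ K × ¬ Laced v ⊎ v ∈ D × ∃ λ w → v ~ w × w ∈ K × ¬ Laced w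

      unlaced? : ∀ v → Dec (Unlaced v)
      unlaced? v = v ∈? K ×-dec ¬? (laced? v) ⊎-dec
        v ∈? D ×-dec any? λ w → v ~? w ×-dec w ∈? K ×-dec ¬? (laced? w)

      -- With the leader in `D`, a cycle through one of its neighbours must pass through the other
      -- centre and both ends, which are all its neighbours.
      leader-unlaced : ∀ {v v₀ w} → v ∈ D → Leader v → v ~ v₀ → v₀ ∈ K → v ~ w → w ∈ K × ¬ Laced w
      leader-unlaced {v} v∈ (b , t , _) vv₀ v₀∈ vw with twin⇒diamond t
      ... | c , d , dia = all-in (Diamond.nbr dia vv₀) vw ,
              λ (¬d , _) → ¬d (inDiamond-mate (centre⇒inDiamond (b , t)) (centre-mate (b , t) vw))
        where
        open Diamond dia
        from-b : b ∈ K → ∀ {w} → v ~ w → w ∈ K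
        from-b b∈ vw with nbr vw
        ... | inj₁ refl = b∈
        ... | inj₂ (inj₁ refl) = stay b∈ bc (λ c∈ → nonadjacent v∈ c∈ ac)
        ... | inj₂ (inj₂ refl) = stay b∈ bd (λ d∈ → nonadjacent v∈ d∈ ad)
        b∉ : b ∉ D
        b∉ b∈ = nonadjacent v∈ b∈ ab
        all-in : _ → ∀ {w} → v ~ w → w ∈ K
        all-in (inj₁ refl) = from-b v₀∈
        all-in (inj₂ (inj₁ refl)) = from-b (stay v₀∈ (~-sym bc) b∉)
        all-in (inj₂ (inj₂ refl)) = from-b (stay v₀∈ (~-sym bd) b∉)

      unlaced-closed : Closed ⟦ unlaced? ⟧
      unlaced-closed v w v∈C vw = ∈⟦⟧⁺ unlaced? (go (∈⟦⟧⁻ unlaced? v∈C))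
        where
        go : Unlaced v → Unlaced w
        go (inj₁ (v∈ , ¬lv)) with w ∈? D
        ... | yes w∈ = inj₂ (w∈ , v , ~-sym vw , v∈ , ¬lv)
        ... | no w∉ = inj₁ (stay v∈ vw w∉ , λ lw → ¬lv (laced-nbr (stay v∈ vw w∉) lw (~-sym vw) v∈))
        go (inj₂ (v∈ , v₀ , vv₀ , v₀∈ , ¬lv₀)) with kind v∈
        ... | inj₁ cv = contradiction (candidate-off-unlaced v∈ cv vv₀ v₀∈) ¬lv₀
        ... | inj₂ lv = inj₁ (leader-unlaced v∈ lv vv₀ v₀∈ vw)

      -- Bumped vertices are candidates, so this keeps the two kinds of vertices of the fourth
      -- colour in different components.
      candidate-not-linked : ∀ {u v} → u ∈ K → ¬ Laced u → v ∈ D → Candidate v → ¬ Linked u v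
      candidate-not-linked u∈ ¬lu v∈ cv link
        with ∈⟦⟧⁻ unlaced? (link ⟦ unlaced? ⟧ unlaced-closed (∈⟦⟧⁺ unlaced? (inj₁ (u∈ , ¬lu))))
      ... | inj₁ (v∈K , _) = off v∈K v∈
      ... | inj₂ (_ , w , vw , w∈ , ¬lw) = ¬lw (candidate-off-unlaced v∈ cv vw w∈)

    -- One representative in each component

    OnUnlacedCycle : V G → Set
    OnUnlacedCycle u = (∃ λ K → Cyclic D K × u ∈ K) × ¬ Laced u

    onUnlacedCycle? : ∀ u → Dec (OnUnlacedCycle u)
    onUnlacedCycle? u = anySubset? (λ K → cyclic? D K ×-dec u ∈? K) ×-dec ¬? (laced? u)

    Representative : V G → Set
    Representative u = OnUnlacedCycle u × (∀ w → OnUnlacedCycle w → w Fin.< u → ¬ Linked u w)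

    representative? : ∀ u → Dec (Representative u)
    representative? u = onUnlacedCycle? u ×-dec
      all? λ w → onUnlacedCycle? w →-dec w <? u →-dec ¬? (linked? u w)

    representative-exists : ∀ {u} → OnUnlacedCycle u → ∃ λ r → Representative r × Linked u r
    representative-exists {u} = go (<-wellFoundedᶠ u)
      where
      go : ∀ {u} → Acc Fin._<_ u → OnUnlacedCycle u → ∃ λ r → Representative r × Linked u r
      go {u} (acc rec) ou with any? (λ w → onUnlacedCycle? w ×-dec w <? u ×-dec linked? u w)
      ... | no none = u , (ou , λ w ow w<u uw → none (w , ow , w<u , uw)) , λ _ _ u∈ → u∈
      ... | yes (w , ow , w<u , uw) with go (rec w<u) ow
      ... | r , rep , wr = r , rep , λ C cl u∈ → wr C cl (uw C cl u∈)

    representative-unique : ∀ {u v} → Representative u → Representative v → Linked u v → Linked v u → u ≡ v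
    representative-unique {u} {v} (ou , least) (ov , least′) uv vu with Fin.<-cmp u v
    ... | tri< u<v _ _ = contradiction vu (least′ u ou u<v)
    ... | tri≈ _ u≡v _ = u≡v
    ... | tri> _ _ v<u = contradiction uv (least v ov v<u)

    plain? : ∀ v → Dec (v ∉ D × ¬ Representative v)
    plain? v = ¬? (v ∈? D) ×-dec ¬? (representative? v)

    -- If a core left by peeling had an unlaced vertex, its unlaced part with the neighbours in `D`
    -- would contain the whole component and so its representative, which is not plain.
    plain-colouring : Colourable ⟦ plain? ⟧
    plain-colouring = peel ⟦ plain? ⟧ λ B B⊆ two → laced-colouring (all-laced B B⊆ two)
      where
      all-laced : ∀ B → B ⊆ ⟦ plain? ⟧ → (∀ {u} → u ∈ B → Two B u) → ∀ {u} → u ∈ B → Laced u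
      all-laced B B⊆ two {u} u∈ = decidable-stable (laced? u) contra
        where
        plain : ∀ {v} → v ∈ B → v ∉ D × ¬ Representative v
        plain v∈ = ∈⟦⟧⁻ plain? (B⊆ v∈)
        cyc : Cyclic D B
        cyc = two⇒cyclic valid (proj₁ ∘ plain) two
        contra : ¬ ¬ Laced u
        contra ¬lu with representative-exists ((B , cyc , u∈) , ¬lu)
        ... | r , rep@(((K , cycK , r∈K) , _) , _) , link
          with ∈⟦⟧⁻ (unlaced? cyc) (link ⟦ unlaced? cyc ⟧ (unlaced-closed cyc) (∈⟦⟧⁺ (unlaced? cyc) (inj₁ (u∈ , ¬lu))))
        ... | inj₁ (r∈ , _) = proj₂ (plain r∈) rep
        ... | inj₂ (r∈ , _) = off cycK r∈K r∈

    -- Assembling the four classes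

    module _ (s : ℕ) (far : ∀ {u v} → Bumped u → Bumped v → u ≢ v → ¬ DistLe G u v s)
             (c : V G → Bool) (proper : ∀ {u v} → u ∈ ⟦ plain? ⟧ → v ∈ ⟦ plain? ⟧ → u ~ v → c u ≢ c v) where
      private
        sizes : Vec ℕ 4
        sizes = 1 ∷ 1 ∷ 2 ∷ s ∷ []

      data Class (v : V G) : Fin 4 → Set where
        white  : v ∈ ⟦ plain? ⟧ → c v ≡ true → Class v zero
        black  : v ∈ ⟦ plain? ⟧ → c v ≡ false → Class v (suc zero)
        chosen : v ∈ D → ¬ Bumped v → Class v (suc (suc zero))
        bumped : v ∈ D → Bumped v → Class v (suc (suc (suc zero)))
        repr   : Representative v → Class v (suc (suc (suc zero)))

      two-tone : ∀ {v} → v ∈ ⟦ plain? ⟧ → Dec (c v ≡ true) → ∃ (Class v)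
      two-tone v∈ (yes t) = _ , white v∈ t
      two-tone v∈ (no ¬t) = _ , black v∈ (¬-not ¬t)

      class : ∀ {v} → Dec (v ∈ D) → Dec (Bumped v) → Dec (Representative v) → ∃ (Class v)
      class (yes v∈) (yes bv) _ = _ , bumped v∈ bv
      class (yes v∈) (no ¬bv) _ = _ , chosen v∈ ¬bv
      class (no _) _ (yes r) = _ , repr r
      class (no v∉) _ (no ¬r) = two-tone (∈⟦⟧⁺ plain? (v∉ , ¬r)) (c _ Bool.≟ true)

      plain-far : ∀ {u v} → u ≢ v → u ∈ ⟦ plain? ⟧ → v ∈ ⟦ plain? ⟧ → c u ≡ c v → ¬ DistLe G u v 1
      plain-far u≢v _ _ _ (_ , _ , here) = u≢v refl
      plain-far _ u∈ v∈ cu≡cv (_ , _ , step uv here) = proper u∈ v∈ uv cu≡cv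
      plain-far _ _ _ _ (_ , s≤s () , step _ (step _ _))

      chosen-far : ∀ {u v} → u ≢ v → u ∈ D → ¬ Bumped u → v ∈ D → ¬ Bumped v → ¬ DistLe G u v 2
      chosen-far u≢v _ _ _ _ (_ , _ , here) = u≢v refl
      chosen-far _ u∈ _ v∈ _ (_ , _ , step uv here) = nonadjacent u∈ v∈ uv
      chosen-far u≢v u∈ ¬bu v∈ ¬bv (_ , _ , step uw (step wv here)) = unbumped-far u∈ v∈ ¬bu ¬bv u≢v uw (~-sym wv)
      chosen-far _ _ _ _ _ (_ , s≤s (s≤s ()) , step _ (step _ (step _ _)))

      -- In the fourth class a representative shares its component with no other member, so `s`
      -- matters only between two bumped vertices.
      separate : ∀ {u v i j} → u ≢ v → Class u i → Class v j → i ≡ j → ¬ DistLe G u v (lookup sizes i)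
      separate u≢v (white u∈ cu) (white v∈ cv) _ = plain-far u≢v u∈ v∈ (trans cu (sym cv))
      separate u≢v (black u∈ cu) (black v∈ cv) _ = plain-far u≢v u∈ v∈ (trans cu (sym cv))
      separate u≢v (chosen u∈ ¬bu) (chosen v∈ ¬bv) _ = chosen-far u≢v u∈ ¬bu v∈ ¬bv
      separate u≢v (bumped _ bu) (bumped _ bv) _ = far bu bv u≢v
      separate u≢v (bumped u∈ bu) (repr (((_ , cyc , v∈) , ¬lv) , _)) _ (_ , _ , walk) =
        candidate-not-linked cyc v∈ ¬lv u∈ (proj₁ bu) (walk⇒linked′ walk)
      separate u≢v (repr (((_ , cyc , u∈) , ¬lu) , _)) (bumped v∈ bv) _ (_ , _ , walk) =
        candidate-not-linked cyc u∈ ¬lu v∈ (proj₁ bv) (walk⇒linked walk)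
      separate u≢v (repr ru) (repr rv) _ (_ , _ , walk) =
        u≢v (representative-unique ru rv (walk⇒linked walk) (walk⇒linked′ walk))

      assemble : PackingColorable G sizes
      assemble = (λ v → proj₁ (classify v)) , λ u v u≢v → separate u≢v (proj₂ (classify u)) (proj₂ (classify v))
        where
        classify : ∀ v → ∃ (Class v)
        classify v = class (v ∈? D) (bumped? v) (representative? v)

    packing : ∀ s → (∀ {u v} → Bumped u → Bumped v → u ≢ v → ¬ DistLe G u v s) →
      PackingColorable G (1 ∷ 1 ∷ 2 ∷ s ∷ [])
    packing s far = assemble s far (proj₁ plain-colouring) (proj₂ plain-colouring)

-- From local girth to triangles, and the conclusion

g3⇒inTri : (G : Graph) → Subcubic G → G3Eq G 3 → ∀ {u} → Adjacency.Deg3 G u → Triangles.InTri G u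
g3⇒inTri G subcubic (girth , _) {u} 3u with girth u (Subcubic-Graph.Deg3⇒deg≡3 G subcubic 3u)
... | _ , ((zero , refl , C , i , refl) , _) , _ = at i
  where
  open Triangles G
  open Cycle C
  triangle : Triangle (vert zero) (vert (suc zero)) (vert (suc (suc zero)))
  triangle = adj zero , ~-sym close , adj (suc zero)
  at : ∀ i → InTri (vert i)
  at zero = _ , _ , triangle
  at (suc zero) = _ , _ , rotate triangle
  at (suc (suc zero)) = _ , _ , rotate (rotate triangle)
... | _ , ((suc _ , refl , _) , _) , s≤s (s≤s (s≤s ()))

theorem6 : (G : Graph) → Subcubic G → G3Eq G 3 →
    (Saturated3 G 0 → PackingColorable G (1 ∷ 1 ∷ 2 ∷ 4 ∷ []))
    × (Saturated3 G 1 → PackingColorable G (1 ∷ 1 ∷ 2 ∷ 3 ∷ []))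
theorem6 G subcubic g3 =
  -- Saturation with bound 0 implies bound 1, so the same structure applies; with nothing bumped,
  -- the distance condition for 4 is vacuous.
  (λ sat₀ → let open LocalStructure G subcubic (λ v hv → ℕ.≤-trans (sat₀ v hv) z≤n) (g3⇒inTri G subcubic g3)
                D , valid , rigid = rigid-exists
            in packing valid rigid 4 λ bu → contradiction bu (no-bumped sat₀)) ,
  (λ sat₁ → let open LocalStructure G subcubic sat₁ (g3⇒inTri G subcubic g3)
                D , valid , rigid = rigid-exists
            in packing valid rigid 3 bumped-far)
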